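{- Let $T$ be a unimodular tournament on $n$ vertices, and let $S$ be its skew-adjacency matrix. Then all off-diagonal entries of $S^{ -1}$ are odd integers. Moreover, the following assertions are equivalent: (i) $T$ is invertible. (ii) Every subtournament of $T$ on $n-2$ vertices is unimodular. (iii) The coefficient of $x^{2}$ in the characteristic polynomial of $S$ is $\binom{n}{2}$.
   Context: The skew-adjacency matrix of a tournament with vertex set $\{v_1,\ldots,v_n\}$ is the $n\times n$ zero-diagonal matrix $S=[s_{ij}]$ in which $s_{ij}=1$ and $s_{ji}=-1$ if $v_i$ dominates $v_j$. The determinant of a tournament is the determinant of its skew-adjacency matrix, and a tournament is unimodular if its determinant is $1$ (by convention the empty tournament has determinant $1$). A unimodular tournament $T$ with skew-adjacency matrix $S$ is invertible if $S^{ -1}$ is the skew-adjacency matrix of a tournament. The characteristic polynomial of $S$ is the monic polynomial $\phi_S(x)=\det(xI_n-S)$. A subtournament is the tournament induced on a subset of the vertices. -}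

module Defs where

open import Algebra.Bundles.Raw using (RawRing)
import Algebra.Definitions.RawSemiring as RawSemiringDefinitions
open import Data.Bool.Base using (if_then_else_)
open import Data.Fin.Base using (Fin; zero; suc; toℕ)
open import Data.Fin.Properties using (_≟_; suc-injective)
open import Data.Fin.Subset using (Subset; inside; outside; ∣_∣)
open import Data.Integer.Base as ℤ using (ℤ; 0ℤ; 1ℤ; -1ℤ; +_)
open import Data.List.Base as List using (List; []; _∷_)
open import Data.Nat.Base as ℕ using (ℕ; zero; suc)
open import Data.Product.Base using (_×_; ∃-syntax)
open import Data.Rational.Base as ℚ using (ℚ)
open import Data.Rational.Literals using (fromℤ)
open import Data.Vec.Base using ([]; _∷_)
open import Data.Vec.Functional using (Vector; removeAt)
open import Function.Base using (_∘_)
open import Function.Definitions using (Injective)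
open import Level using (Level; 0ℓ)
open import Relation.Binary.Core using (Rel)
open import Relation.Binary.Definitions using (Tri; tri<; tri≈; tri>; Trichotomous)
open import Relation.Binary.PropositionalEquality.Core using (_≡_; refl; cong)
open import Relation.Nullary.Decidable.Core using (does)

private
  variable
    a c ℓ : Level
    m n o : ℕ

Matrix : Set a → ℕ → ℕ → Set a
Matrix A m n = Fin m → Fin n → A

module _ (R : RawRing c ℓ) where
  open RawRing R
  open RawSemiringDefinitions rawSemiring using (sum; _^_)

  identity : ∀ n → Matrix Carrier n n
  identity n i j = if does (i ≟ j) then 1# else 0#

  multiply : Matrix Carrier m n → Matrix Carrier n o → Matrix Carrier m o
  multiply A B i j = sum (λ k → A i k * B k j)

  IsInverse : Matrix Carrier n n → Matrix Carrier n n → Set ℓ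
  IsInverse {n} A B =
    (∀ i j → multiply A B i j ≈ identity n i j) ×
    (∀ i j → multiply B A i j ≈ identity n i j)

  -- Laplace expansion along the first row; the empty matrix has determinant 1.
  det : Matrix Carrier n n → Carrier
  det {zero}  A = 1#
  det {suc n} A = sum (λ j →
    (- 1#) ^ toℕ j * (A zero j * det (λ i → removeAt (A (suc i)) j)))

-- Coefficient lists, constant term first.  Trailing zeros are allowed, so the
-- equality of polynomials is equality of all coefficients.
module Polynomial (R : RawRing c ℓ) where
  open RawRing R

  Poly : Set c
  Poly = List Carrier

  coeff : Poly → ℕ → Carrier
  coeff []      k       = 0#
  coeff (a ∷ p) zero    = a
  coeff (a ∷ p) (suc k) = coeff p k

  addₚ : Poly → Poly → Poly
  addₚ []      q       = q
  addₚ (a ∷ p) []      = a ∷ p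
  addₚ (a ∷ p) (b ∷ q) = a + b ∷ addₚ p q

  -- (a + x p) q = a q + x (p q)
  mulₚ : Poly → Poly → Poly
  mulₚ []      q = []
  mulₚ (a ∷ p) q = addₚ (List.map (a *_) q) (0# ∷ mulₚ p q)

  constant : Carrier → Poly
  constant a = a ∷ []

  indeterminate : Poly
  indeterminate = 0# ∷ 1# ∷ []

  polyRawRing : RawRing c ℓ
  polyRawRing = record
    { Carrier = Poly
    ; _≈_     = λ p q → ∀ k → coeff p k ≈ coeff q k
    ; _+_     = addₚ
    ; _*_     = mulₚ
    ; -_      = List.map (-_)
    ; 0#      = []
    ; 1#      = constant 1#
    }

  charPoly : Matrix Carrier n n → Poly
  charPoly {n} A = det polyRawRing λ i j →
    indeterminate *ₚ identity polyRawRing n i j +ₚ (-ₚ constant (A i j))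
    where
    open RawRing polyRawRing using ()
      renaming (_+_ to infixl 6 _+ₚ_; _*_ to infixl 7 _*ₚ_; -_ to infix 8 -ₚ_)

ℤ-rawRing : RawRing 0ℓ 0ℓ
ℤ-rawRing = ℤ.+-*-rawRing

ℚ-rawRing : RawRing 0ℓ 0ℓ
ℚ-rawRing = ℚ.+-*-rawRing

open Polynomial ℤ-rawRing public using (Poly; coeff; charPoly)

toℚ : Matrix ℤ m n → Matrix ℚ m n
toℚ A i j = fromℤ (A i j)

Odd : ℤ → Set
Odd k = ∃[ l ] k ≡ + 2 ℤ.* l ℤ.+ 1ℤ

-- Trichotomy says that no vertex dominates itself and that, of two distinct
-- vertices, exactly one dominates the other.
record Tournament (n : ℕ) : Set₁ where
  field
    _dominates_ : Rel (Fin n) 0ℓ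
    compare     : Trichotomous _≡_ _dominates_

open Tournament

skewAdjacency : Tournament n → Matrix ℤ n n
skewAdjacency T i j with compare T i j
... | tri< _ _ _ = 1ℤ
... | tri≈ _ _ _ = 0ℤ
... | tri> _ _ _ = -1ℤ

Unimodular : Tournament n → Set
Unimodular T = det ℤ-rawRing (skewAdjacency T) ≡ 1ℤ

-- Inverses are taken over ℚ: integrality of the inverse is not presupposed.
IsInverseOf : Matrix ℚ n n → Tournament n → Set
IsInverseOf M T = IsInverse ℚ-rawRing (toℚ (skewAdjacency T)) M

Invertible : Tournament n → Set₁
Invertible {n} T =
  Unimodular T × (∃[ T′ ] IsInverseOf (toℚ (skewAdjacency {n} T′)) T)

-- The increasing enumeration of the elements of a subset.
element : (p : Subset n) → Fin ∣ p ∣ → Fin n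
element (outside ∷ p) i       = suc (element p i)
element (inside  ∷ p) zero    = zero
element (inside  ∷ p) (suc i) = suc (element p i)

element-injective : (p : Subset n) → Injective _≡_ _≡_ (element p)
element-injective (outside ∷ p) eq = element-injective p (suc-injective eq)
element-injective (inside ∷ p) {zero}  {zero}  eq = refl
element-injective (inside ∷ p) {suc i} {suc j} eq =
  cong suc (element-injective p (suc-injective eq))

subtournament : Tournament n → (p : Subset n) → Tournament ∣ p ∣
subtournament T p = record
  { _dominates_ = λ i j → _dominates_ T (element p i) (element p j)
  ; compare     = compare′
  }
  where
  compare′ : Trichotomous _≡_ (λ i j → _dominates_ T (element p i) (element p j))
  compare′ i j with compare T (element p i) (element p j)
  ... | tri< d i≢j ¬d = tri< d (i≢j ∘ cong (element p)) ¬d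
  ... | tri≈ ¬d i≡j ¬e = tri≈ ¬d (element-injective p i≡j) ¬e
  ... | tri> ¬d i≢j d = tri> ¬d (i≢j ∘ cong (element p)) d

{-# OPTIONS --safe #-}

-- Put B = adj S, so that S B = I because det S = 1.  Transposing shows that B is skew and also a
-- left inverse.  Modulo 2, S = J - I; its column sums force n to be even, and then S S = I, so that
-- B = S modulo 2 and the off-diagonal entries of B are odd.  Since e_i = Σ_l B i l S_l, Cramer's rule
-- in two rows shows that the determinant of S with rows i and k replaced by e_i and e_k is
-- B i i B k k - B i k B k i = (B i k)².  On the one hand this is the principal minor of S omitting
-- i and k; on the other hand half its sum over all i ≠ k is the coefficient of x² in det (x I - S).
-- As (B i k)² ≥ 1, that coefficient is n C 2 exactly when every B i k is ±1, i.e. when every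
-- (n - 2)-subtournament is unimodular, i.e. when B is the skew-adjacency matrix of a tournament.
module Submission where

open import Defs
open import Algebra.Bundles using (Ring)
open import Algebra.Bundles.Raw using (RawRing)
import Algebra.Definitions.RawSemiring as RawSemiringDefinitions
import Algebra.Properties.Semiring.Sum
open import Data.Bool.Base using (if_then_else_; true; false)
open import Data.Fin.Base using (Fin; zero; suc; toℕ; punchIn; pinch; punchOut; cast)
open import Data.Fin.Properties using (_≟_; cast-is-id; punchIn-punchOut; punchInᵢ≢i)
open import Data.Fin.Subset using (Subset; outside; inside; ∣_∣; ⊤)
open import Data.Fin.Subset.Properties using (∣⊤∣≡n; ∣p∣≡n⇒p≡⊤)
open import Data.Integer.Base as ℤ using (ℤ; +_; 0ℤ; 1ℤ; -1ℤ; _*_; -_)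
  renaming (_+_ to _⊕_)
import Data.Integer.Divisibility.Signed as ℤ
import Data.Integer.Properties as ℤ
open import Data.Integer.Tactic.RingSolver using (solve-∀)
open import Data.List.Base as List using ([]; _∷_)
open import Data.Nat.Base as ℕ using (ℕ; zero; suc; _+_)
open import Data.Nat.Combinatorics using (_C_; nC1≡n; nCk+nC[k+1]≡[n+1]C[k+1])
import Data.Nat.Divisibility as ℕ
import Data.Nat.Properties as ℕ
open import Data.Product.Base using (_×_; ∃-syntax; _,_; proj₁; proj₂)
open import Data.Rational.Base as ℚ using (ℚ)
import Data.Rational.Properties as ℚ
open import Data.Rational.Literals using (fromℤ)
open import Data.Sum.Base using (_⊎_; inj₁; inj₂)
open import Data.Vec.Base using (_∷_; insertAt)
open import Data.Vec.Functional using (Vector; removeAt; updateAt)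
open import Data.Vec.Functional.Properties using
  (updateAt-updates; updateAt-minimal; updateAt-id-local; updateAt-commutes)
open import Function.Base using (_∘_; const)
open import Function.Bundles using (_⇔_; mk⇔; Equivalence)
open import Function.Properties.Equivalence using () renaming (sym to ⇔-sym; trans to ⇔-trans)
open import Relation.Binary.Definitions using (Tri; tri<; tri≈; tri>)
open import Relation.Binary.PropositionalEquality
open import Relation.Nullary using (does; yes; no; contradiction)
open import Algebra.Properties.Semiring.Sum ℤ.+-*-semiring
open RawSemiringDefinitions ℤ.+-*-rawSemiring using (_^_)

open ≡-Reasoning

private
  variable
    m n o : ℕ

-- The determinant is available only as an expansion along the first row, so the whole argument is
-- phrased in terms of replacing rows, `A [ i ≔ u ]`: linearity and alternation in the rows yield
-- both the adjugate and Jacobi's identity. This gives only the right inverse `S B = I`; the other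
-- side has to come from skewness. Unit rows are the meeting point of the two quantities to be
-- compared. Expanding along unit rows `δ i` and `δ k` leaves the principal minor omitting `i` and
-- `k`, while differentiating `det (- S + x I)` twice at `x = 0` replaces two rows of `- S` by rows
-- of `I`. The second computation takes place at `- S`, whose determinant is `(-1)^n det S`, so the
-- evenness of `n` found in the parity argument serves once more. The coefficient of `x²` is doubled
-- throughout: the pairs of rows can then be ordered, and the sum becomes the sum of all squared
-- entries of `B`.

determinant : Matrix ℤ n n → ℤ
determinant = det ℤ-rawRing

-- Laplace expansion along an arbitrary row

sgn : Fin n → ℤ
sgn j = -1ℤ ^ toℕ j

minor : Matrix ℤ (suc m) (suc n) → Fin (suc m) → Fin (suc n) → Matrix ℤ m n
minor A i j r = removeAt (A (punchIn i r)) j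

det-cong : {A B : Matrix ℤ n n} → (∀ i j → A i j ≡ B i j) → determinant A ≡ determinant B
det-cong {zero}  A≗B = refl
det-cong {suc n} A≗B = sum-cong-≗ λ j →
  cong (sgn j *_) (cong₂ _*_ (A≗B zero j) (det-cong λ r c → A≗B (suc r) (punchIn j c)))

-- An ordered pair of distinct columns is coded as a column and the position of the other one after
-- its deletion. Exchanging the two turns `(j , k)` into `(punchIn j k , pinch k j)`. In the
-- induction, the pairs starting with column `zero` trade places with those ending in it.
∑-pairs-swap : (f : Fin (suc n) → Fin n → ℤ) →
  sum (λ j → sum (f j)) ≡ sum (λ j → sum (λ k → f (punchIn j k) (pinch k j)))
∑-pairs-swap {zero}  f = refl
∑-pairs-swap {suc n} f = begin
  sum (f zero) ⊕ sum (λ j → f (suc j) zero ⊕ sum (f′ j))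
    ≡⟨ cong (sum (f zero) ⊕_) (∑-distrib-+ (λ j → f (suc j) zero) (λ j → sum (f′ j))) ⟩
  sum (f zero) ⊕ (sum (λ j → f (suc j) zero) ⊕ sum (λ j → sum (f′ j)))
    ≡⟨ cong (λ z → sum (f zero) ⊕ (sum (λ j → f (suc j) zero) ⊕ z)) (∑-pairs-swap f′) ⟩
  sum (f zero) ⊕ (sum (λ j → f (suc j) zero) ⊕ sum g)
    ≡⟨ exchange (sum (f zero)) (sum (λ j → f (suc j) zero)) (sum g) ⟩
  sum (λ j → f (suc j) zero) ⊕ (sum (f zero) ⊕ sum g)
    ≡⟨ cong (sum (λ j → f (suc j) zero) ⊕_) (∑-distrib-+ (f zero) g) ⟨
  sum (λ j → f (suc j) zero) ⊕ sum (λ j → f zero j ⊕ g j) ∎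
  where
  f′ : Fin (suc n) → Fin n → ℤ
  f′ j k = f (suc j) (suc k)
  g : Fin (suc n) → ℤ
  g j = sum (λ k → f′ (punchIn j k) (pinch k j))
  exchange : ∀ a b c → a ⊕ (b ⊕ c) ≡ b ⊕ (a ⊕ c)
  exchange = solve-∀

punchIn-pinch : ∀ (j : Fin (suc n)) k → punchIn (punchIn j k) (pinch k j) ≡ j
punchIn-pinch zero    zero    = refl
punchIn-pinch zero    (suc k) = refl
punchIn-pinch (suc j) zero    = refl
punchIn-pinch (suc j) (suc k) = cong suc (punchIn-pinch j k)

punchIn-comm : ∀ (j : Fin (suc (suc n))) k c →
  punchIn (punchIn j k) (punchIn (pinch k j) c) ≡ punchIn j (punchIn k c)
punchIn-comm zero    zero    c       = refl
punchIn-comm zero    (suc k) c       = refl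
punchIn-comm (suc j) zero    c       = refl
punchIn-comm (suc j) (suc k) zero    = refl
punchIn-comm (suc j) (suc k) (suc c) = cong suc (punchIn-comm j k c)

-- Deleting one of two columns lowers the position of the other exactly when the other is the larger
-- one. Hence the two orders of deletion give position sums that differ by one.
sgn-swap : ∀ (j : Fin (suc n)) k →
  sgn (punchIn j k) * sgn (pinch k j) ≡ -1ℤ * (sgn j * sgn k)
sgn-swap zero zero    = refl
sgn-swap zero (suc k) = lemma (sgn k)
  where
  lemma : ∀ x → (-1ℤ * (-1ℤ * x)) * 1ℤ ≡ -1ℤ * (1ℤ * (-1ℤ * x))
  lemma = solve-∀
sgn-swap (suc j) zero = lemma (sgn j)
  where
  lemma : ∀ x → 1ℤ * x ≡ -1ℤ * ((-1ℤ * x) * 1ℤ)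
  lemma = solve-∀
sgn-swap (suc j) (suc k) = begin
  (-1ℤ * sgn (punchIn j k)) * (-1ℤ * sgn (pinch k j))  ≡⟨ lemma₁ (sgn (punchIn j k)) _ ⟩
  sgn (punchIn j k) * sgn (pinch k j)                   ≡⟨ sgn-swap j k ⟩
  -1ℤ * (sgn j * sgn k)                                 ≡⟨ cong (-1ℤ *_) (lemma₁ (sgn j) (sgn k)) ⟨
  -1ℤ * ((-1ℤ * sgn j) * (-1ℤ * sgn k))                ∎
  where
  lemma₁ : ∀ x y → (-1ℤ * x) * (-1ℤ * y) ≡ x * y
  lemma₁ = solve-∀

-- Row `suc i` survives in every minor along row `zero`, where the induction hypothesis expands it.
-- The resulting sum over ordered pairs of columns is the one obtained by expanding along row
-- `suc i` first and row `zero` second; exchanging the columns costs one sign, the difference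
-- between `sgn i` and `sgn (suc i)`.
laplace : ∀ (A : Matrix ℤ (suc n) (suc n)) i →
  determinant A ≡ sum (λ j → (sgn i * sgn j) * (A i j * determinant (minor A i j)))
laplace A zero = sum-cong-≗ λ j → cong (_* (A zero j * determinant (minor A zero j))) (sym (ℤ.*-identityˡ (sgn j)))
laplace {suc n} A (suc i) = begin
  sum (λ j → sgn j * (A zero j * determinant (minor A zero j)))
    ≡⟨ sum-cong-≗ (λ j → trans (cong (λ z → sgn j * (A zero j * z)) (laplace (minor A zero j) i))
        (trans (cong (sgn j *_) (*-distribˡ-sum (A zero j) (inner j))) (*-distribˡ-sum (sgn j) (λ k → A zero j * inner j k)))) ⟩
  sum (λ j → sum (F j))
    ≡⟨ sum-cong-≗ (λ j → sum-cong-≗ (λ k → F≡G j k)) ⟩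
  sum (λ j → sum (λ k → G (punchIn j k) (pinch k j)))
    ≡⟨ ∑-pairs-swap G ⟨
  sum (λ c → sum (G c))
    ≡⟨ sum-cong-≗ (λ c → trans (cong ((sgn (suc i) * sgn c) *_) (*-distribˡ-sum (A (suc i) c) (inner′ c)))
         (*-distribˡ-sum (sgn (suc i) * sgn c) (λ j → A (suc i) c * inner′ c j))) ⟨
  sum (λ c → (sgn (suc i) * sgn c) * (A (suc i) c * determinant (minor A (suc i) c))) ∎
  where
  inner : Fin (suc (suc n)) → Fin (suc n) → ℤ
  inner j k = (sgn i * sgn k) * (minor A zero j i k * determinant (minor (minor A zero j) i k))
  inner′ : Fin (suc (suc n)) → Fin (suc n) → ℤ
  inner′ c j = sgn j * (A zero (punchIn c j) * determinant (minor (minor A (suc i) c) zero j))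
  F G : Fin (suc (suc n)) → Fin (suc n) → ℤ
  F j k = sgn j * (A zero j * inner j k)
  G c j = (sgn (suc i) * sgn c) * (A (suc i) c * inner′ c j)
  shuffle₁ : ∀ sj sk si a b d → sj * (a * ((si * sk) * (b * d))) ≡
    (-1ℤ * (sj * sk)) * ((-1ℤ * si) * (b * (a * d)))
  shuffle₁ = solve-∀
  shuffle₂ : ∀ u v w a b d → (u * v) * (w * (b * (a * d))) ≡ (w * u) * (b * (v * (a * d)))
  shuffle₂ = solve-∀
  F≡G : ∀ j k → F j k ≡ G (punchIn j k) (pinch k j)
  F≡G j k = begin
    F j k
      ≡⟨ shuffle₁ (sgn j) (sgn k) (sgn i) (A zero j) b d ⟩
    (-1ℤ * (sgn j * sgn k)) * (sgn (suc i) * (b * (A zero j * d)))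
      ≡⟨ cong₂ (λ s t → s * (sgn (suc i) * (b * t))) (sgn-swap j k)
           (cong₂ _*_ (cong (A zero) (punchIn-pinch j k))
             (det-cong λ r c → cong (A (suc (punchIn i r))) (punchIn-comm j k c))) ⟨
    (sgn (punchIn j k) * sgn (pinch k j)) * (sgn (suc i) * (b * (a′ * d′)))
      ≡⟨ shuffle₂ (sgn (punchIn j k)) (sgn (pinch k j)) (sgn (suc i)) a′ b d′ ⟩
    G (punchIn j k) (pinch k j) ∎
    where
    b d a′ d′ : ℤ
    b = A (suc i) (punchIn j k)
    d = determinant (minor (minor A zero j) i k)
    a′ = A zero (punchIn (punchIn j k) (pinch k j))
    d′ = determinant (minor (minor A (suc i) (punchIn j k)) zero (pinch k j))

-- Determinants as alternating functions of the rows

infixl 10 _[_≔_]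
_[_≔_] : Matrix ℤ m n → Fin m → Vector ℤ n → Matrix ℤ m n
A [ i ≔ u ] = updateAt A i (const u)

≔-updated : ∀ (A : Matrix ℤ m n) i u → (A [ i ≔ u ]) i ≡ u
≔-updated A i u = updateAt-updates i {const u} A

≔-minimal : ∀ (A : Matrix ℤ m n) {r i} u → r ≢ i → (A [ i ≔ u ]) r ≡ A r
≔-minimal A {r} {i} u r≢i = updateAt-minimal r i {const u} A r≢i

δ : Fin n → Fin n → ℤ
δ = identity ℤ-rawRing _

δ-diagonal : (i : Fin n) → δ i i ≡ 1ℤ
δ-diagonal zero    = refl
δ-diagonal (suc i) = δ-diagonal i

δ-off-diagonal : {i j : Fin n} → i ≢ j → δ i j ≡ 0ℤ
δ-off-diagonal {i = i} {j} i≢j with i ≟ j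
... | yes i≡j = contradiction i≡j i≢j
... | no  _   = refl

δ-sym : (i j : Fin n) → δ i j ≡ δ j i
δ-sym zero    zero    = refl
δ-sym zero    (suc j) = refl
δ-sym (suc i) zero    = refl
δ-sym (suc i) (suc j) = δ-sym i j

∑-zero : {f : Vector ℤ n} → (∀ i → f i ≡ 0ℤ) → sum f ≡ 0ℤ
∑-zero {n} f≗0 = trans (sum-cong-≗ f≗0) (sum-replicate-zero n)

∑-δ : ∀ (y : Vector ℤ n) i → sum (λ k → y k * δ k i) ≡ y i
∑-δ {suc n} y zero = begin
  y zero * 1ℤ ⊕ sum (λ k → y (suc k) * 0ℤ)
    ≡⟨ cong₂ _⊕_ (ℤ.*-identityʳ (y zero)) (∑-zero λ k → ℤ.*-zeroʳ (y (suc k))) ⟩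
  y zero ⊕ 0ℤ
    ≡⟨ ℤ.+-identityʳ (y zero) ⟩
  y zero ∎
∑-δ {suc n} y (suc i) = begin
  y zero * 0ℤ ⊕ sum (λ k → y (suc k) * δ k i)
    ≡⟨ cong₂ _⊕_ (ℤ.*-zeroʳ (y zero)) (∑-δ (y ∘ suc) i) ⟩
  0ℤ ⊕ y (suc i)
    ≡⟨ ℤ.+-identityˡ (y (suc i)) ⟩
  y (suc i) ∎

∑-δ₂ : ∀ (y : Vector ℤ n) i k a b →
  sum (λ l → y l * (δ l i * a ⊕ δ l k * b)) ≡ y i * a ⊕ y k * b
∑-δ₂ y i k a b = begin
  sum (λ l → y l * (δ l i * a ⊕ δ l k * b))
    ≡⟨ sum-cong-≗ (λ l → regroup (y l) (δ l i) (δ l k) a b) ⟩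
  sum (λ l → y l * δ l i * a ⊕ y l * δ l k * b)
    ≡⟨ ∑-distrib-+ (λ l → y l * δ l i * a) (λ l → y l * δ l k * b) ⟩
  sum (λ l → y l * δ l i * a) ⊕ sum (λ l → y l * δ l k * b)
    ≡⟨ cong₂ _⊕_ (*-distribʳ-sum a (λ l → y l * δ l i)) (*-distribʳ-sum b (λ l → y l * δ l k)) ⟨
  sum (λ l → y l * δ l i) * a ⊕ sum (λ l → y l * δ l k) * b
    ≡⟨ cong₂ (λ s t → s * a ⊕ t * b) (∑-δ y i) (∑-δ y k) ⟩
  y i * a ⊕ y k * b ∎
  where
  regroup : ∀ y p q a b → y * (p * a ⊕ q * b) ≡ y * p * a ⊕ y * q * b
  regroup = solve-∀

-- The minors along row `i` do not see that row, so they are fixed coefficients of a linear form in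
-- `u`. Every linearity statement below is read off from this form.
laplace-≔ : ∀ (A : Matrix ℤ (suc n) (suc n)) i u →
  determinant (A [ i ≔ u ]) ≡ sum (λ j → (sgn i * sgn j) * (u j * determinant (minor A i j)))
laplace-≔ A i u = trans (laplace (A [ i ≔ u ]) i) (sum-cong-≗ λ j →
  cong₂ (λ a d → (sgn i * sgn j) * (a * d))
    (cong-app (≔-updated A i u) j)
    (det-cong λ r c → cong-app (≔-minimal A u (punchInᵢ≢i i r)) (punchIn j c)))

det-row-cong : ∀ (A : Matrix ℤ n n) i {u v : Vector ℤ n} → u ≗ v →
  determinant (A [ i ≔ u ]) ≡ determinant (A [ i ≔ v ])
det-row-cong {suc n} A i {u} {v} u≗v = begin
  determinant (A [ i ≔ u ])
    ≡⟨ laplace-≔ A i u ⟩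
  sum (λ j → (sgn i * sgn j) * (u j * determinant (minor A i j)))
    ≡⟨ sum-cong-≗ (λ j → cong (λ a → (sgn i * sgn j) * (a * determinant (minor A i j))) (u≗v j)) ⟩
  sum (λ j → (sgn i * sgn j) * (v j * determinant (minor A i j)))
    ≡⟨ laplace-≔ A i v ⟨
  determinant (A [ i ≔ v ]) ∎

det-row-+ : ∀ (A : Matrix ℤ n n) i (u v : Vector ℤ n) →
  determinant (A [ i ≔ (λ j → u j ⊕ v j) ]) ≡ determinant (A [ i ≔ u ]) ⊕ determinant (A [ i ≔ v ])
det-row-+ {suc n} A i u v = begin
  determinant (A [ i ≔ (λ j → u j ⊕ v j) ])
    ≡⟨ laplace-≔ A i _ ⟩
  sum (λ j → (sgn i * sgn j) * ((u j ⊕ v j) * determinant (minor A i j)))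
    ≡⟨ sum-cong-≗ (λ j → distrib (sgn i * sgn j) (u j) (v j) (determinant (minor A i j))) ⟩
  sum (λ j → term u j ⊕ term v j)
    ≡⟨ ∑-distrib-+ (term u) (term v) ⟩
  sum (term u) ⊕ sum (term v)
    ≡⟨ cong₂ _⊕_ (laplace-≔ A i u) (laplace-≔ A i v) ⟨
  determinant (A [ i ≔ u ]) ⊕ determinant (A [ i ≔ v ]) ∎
  where
  term : Vector ℤ (suc n) → Vector ℤ (suc n)
  term w j = (sgn i * sgn j) * (w j * determinant (minor A i j))
  distrib : ∀ s a b d → s * ((a ⊕ b) * d) ≡ s * (a * d) ⊕ s * (b * d)
  distrib = solve-∀

det-row-combination : ∀ (A : Matrix ℤ n n) i (c : Vector ℤ m) (V : Matrix ℤ m n) →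
  determinant (A [ i ≔ (λ j → sum (λ k → c k * V k j)) ]) ≡
  sum (λ k → c k * determinant (A [ i ≔ V k ]))
det-row-combination {suc n} A i c V = begin
  determinant (A [ i ≔ (λ j → sum (λ k → c k * V k j)) ])
    ≡⟨ laplace-≔ A i _ ⟩
  sum (λ j → s j * (sum (λ k → c k * V k j) * d j))
    ≡⟨ sum-cong-≗ (λ j → trans (cong (s j *_) (*-distribʳ-sum (d j) (λ k → c k * V k j)))
        (trans (*-distribˡ-sum (s j) (λ k → c k * V k j * d j))
          (sum-cong-≗ λ k → regroup (s j) (c k) (V k j) (d j)))) ⟩
  sum (λ j → sum (λ k → c k * (s j * (V k j * d j))))
    ≡⟨ ∑-comm (λ j k → c k * (s j * (V k j * d j))) ⟩
  sum (λ k → sum (λ j → c k * (s j * (V k j * d j))))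
    ≡⟨ sum-cong-≗ (λ k → trans (cong (c k *_) (laplace-≔ A i (V k))) (*-distribˡ-sum (c k) (λ j → s j * (V k j * d j)))) ⟨
  sum (λ k → c k * determinant (A [ i ≔ V k ])) ∎
  where
  s d : Vector ℤ (suc n)
  s j = sgn i * sgn j
  d j = determinant (minor A i j)
  regroup : ∀ s c v d → s * (c * v * d) ≡ c * (s * (v * d))
  regroup = solve-∀

det-zero-minors : ∀ (A : Matrix ℤ (suc n) (suc n)) i →
  (∀ j → determinant (minor A i j) ≡ 0ℤ) → determinant A ≡ 0ℤ
det-zero-minors A i minors≡0 = trans (laplace A i) (∑-zero λ j →
  trans (cong (λ d → (sgn i * sgn j) * (A i j * d)) (minors≡0 j)) (lemma (sgn i * sgn j) (A i j)))
  where
  lemma : ∀ s a → s * (a * 0ℤ) ≡ 0ℤ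
  lemma = solve-∀

-- Expansion along a third row keeps both equal rows in each minor. A two-by-two matrix has no third
-- row and is computed outright.
det-alternating₀ : ∀ (A : Matrix ℤ (suc n) (suc n)) k → A zero ≗ A (suc k) → determinant A ≡ 0ℤ
det-alternating₀ {suc zero} A zero eq = begin
  determinant A
    ≡⟨ cong₂ (λ x y → 1ℤ * (x * (1ℤ * (A (suc zero) (suc zero) * 1ℤ) ⊕ 0ℤ)) ⊕
         (-1ℤ * (y * (1ℤ * (A (suc zero) zero * 1ℤ) ⊕ 0ℤ)) ⊕ 0ℤ)) (eq zero) (eq (suc zero)) ⟩
  _ ≡⟨ lemma (A (suc zero) zero) (A (suc zero) (suc zero)) ⟩
  0ℤ ∎
  where
  lemma : ∀ a b → 1ℤ * (a * (1ℤ * (b * 1ℤ) ⊕ 0ℤ)) ⊕ (-1ℤ * (b * (1ℤ * (a * 1ℤ) ⊕ 0ℤ)) ⊕ 0ℤ) ≡ 0ℤ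
  lemma = solve-∀
det-alternating₀ {suc (suc n)} A zero eq =
  det-zero-minors A (suc (suc zero)) λ j → det-alternating₀ (minor A (suc (suc zero)) j) zero (eq ∘ punchIn j)
det-alternating₀ {suc (suc n)} A (suc k) eq =
  det-zero-minors A (suc zero) λ j → det-alternating₀ (minor A (suc zero) j) k (eq ∘ punchIn j)

det-alternating : ∀ (A : Matrix ℤ n n) {i k} → i ≢ k → A i ≗ A k → determinant A ≡ 0ℤ
det-alternating A {zero}  {zero}  i≢k eq = contradiction refl i≢k
det-alternating A {zero}  {suc k} i≢k eq = det-alternating₀ A k eq
det-alternating A {suc i} {zero}  i≢k eq = det-alternating₀ A i (sym ∘ eq)
det-alternating A {suc i} {suc k} i≢k eq =
  det-zero-minors A zero λ j → det-alternating (minor A zero j) (i≢k ∘ cong suc) (eq ∘ punchIn j)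

det-duplicate-row : ∀ (A : Matrix ℤ n n) {i k} → i ≢ k → determinant (A [ i ≔ A k ]) ≡ 0ℤ
det-duplicate-row A {i} {k} i≢k = det-alternating (A [ i ≔ A k ]) i≢k λ j →
  cong-app (trans (≔-updated A i (A k)) (sym (≔-minimal A (A k) (i≢k ∘ sym)))) j

det-row-own : ∀ (A : Matrix ℤ n n) i → determinant (A [ i ≔ A i ]) ≡ determinant A
det-row-own A i = det-cong λ r c → cong-app (updateAt-id-local i A refl r) c

det-row-δ : ∀ (A : Matrix ℤ n n) i k → determinant (A [ i ≔ A k ]) ≡ δ k i * determinant A
det-row-δ A i k with i ≟ k
... | yes refl = begin
  determinant (A [ i ≔ A i ])  ≡⟨ det-row-own A i ⟩
  determinant A                ≡⟨ ℤ.*-identityˡ (determinant A) ⟨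
  1ℤ * determinant A           ≡⟨ cong (_* determinant A) (δ-diagonal i) ⟨
  δ i i * determinant A        ∎
... | no i≢k = trans (det-duplicate-row A i≢k)
  (sym (cong (_* determinant A) (δ-off-diagonal (i≢k ∘ sym))))

det-≔-comm : ∀ (A : Matrix ℤ n n) {i k} (u v : Vector ℤ n) → i ≢ k →
  determinant (A [ i ≔ u ] [ k ≔ v ]) ≡ determinant (A [ k ≔ v ] [ i ≔ u ])
det-≔-comm A {i} {k} u v i≢k =
  det-cong λ r c → cong-app (updateAt-commutes k i (i≢k ∘ sym) A r) c

-- Polarisation: expand the vanishing determinant with `u + v` in both rows.
det-row-antisym : ∀ (A : Matrix ℤ n n) {i k} (u v : Vector ℤ n) → i ≢ k →
  determinant (A [ i ≔ u ] [ k ≔ v ]) ≡ - determinant (A [ i ≔ v ] [ k ≔ u ])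
det-row-antisym A {i} {k} u v i≢k = solve-for (D u v) (D v u) (begin
  D u v ⊕ D v u
    ≡⟨ lemma (D u v) (D v u) ⟩
  (0ℤ ⊕ D u v) ⊕ (D v u ⊕ 0ℤ)
    ≡⟨ cong₂ (λ x y → (x ⊕ D u v) ⊕ (D v u ⊕ y)) (D-diagonal u) (D-diagonal v) ⟨
  (D u u ⊕ D u v) ⊕ (D v u ⊕ D v v)
    ≡⟨ cong₂ _⊕_ (det-row-+ (A [ i ≔ u ]) k u v) (det-row-+ (A [ i ≔ v ]) k u v) ⟨
  D u w ⊕ D v w
    ≡⟨ cong₂ _⊕_ (det-≔-comm A u w i≢k) (det-≔-comm A v w i≢k) ⟩
  determinant (A [ k ≔ w ] [ i ≔ u ]) ⊕ determinant (A [ k ≔ w ] [ i ≔ v ])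
    ≡⟨ det-row-+ (A [ k ≔ w ]) i u v ⟨
  determinant (A [ k ≔ w ] [ i ≔ w ])
    ≡⟨ det-≔-comm A w w i≢k ⟨
  D w w
    ≡⟨ D-diagonal w ⟩
  0ℤ ∎)
  where
  w : Vector ℤ _
  w j = u j ⊕ v j
  D : Vector ℤ _ → Vector ℤ _ → ℤ
  D x y = determinant (A [ i ≔ x ] [ k ≔ y ])
  D-diagonal : ∀ x → D x x ≡ 0ℤ
  D-diagonal x = det-alternating (A [ i ≔ x ] [ k ≔ x ]) i≢k λ j → cong-app
    (trans (≔-minimal (A [ i ≔ x ]) x i≢k)
      (trans (≔-updated A i x) (sym (≔-updated (A [ i ≔ x ]) k x)))) j
  lemma : ∀ x y → x ⊕ y ≡ (0ℤ ⊕ x) ⊕ (y ⊕ 0ℤ)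
  lemma = solve-∀
  cancel : ∀ x y → x ≡ (x ⊕ y) ⊕ - y
  cancel = solve-∀
  solve-for : ∀ x y → x ⊕ y ≡ 0ℤ → x ≡ - y
  solve-for x y x+y≡0 = trans (cancel x y) (trans (cong (_⊕ - y) x+y≡0) (ℤ.+-identityˡ (- y)))

cramer : ∀ (A : Matrix ℤ n n) i (y : Vector ℤ n) →
  determinant (A [ i ≔ (λ j → sum (λ k → y k * A k j)) ]) ≡ y i * determinant A
cramer A i y = begin
  determinant (A [ i ≔ (λ j → sum (λ k → y k * A k j)) ])
    ≡⟨ det-row-combination A i y A ⟩
  sum (λ k → y k * determinant (A [ i ≔ A k ]))
    ≡⟨ sum-cong-≗ (λ k → trans (cong (y k *_) (det-row-δ A i k)) (sym (ℤ.*-assoc (y k) _ _))) ⟩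
  sum (λ k → y k * δ k i * determinant A)
    ≡⟨ *-distribʳ-sum (determinant A) (λ k → y k * δ k i) ⟨
  sum (λ k → y k * δ k i) * determinant A
    ≡⟨ cong (_* determinant A) (∑-δ y i) ⟩
  y i * determinant A ∎

-- The factor of `determinant A` is the minor of the identity matrix in rows `l`, `m` and columns
-- `i`, `k`. It is grouped by `l` so that `∑-δ₂` can sum it against the coefficients of a row
-- combination.
det-two-rows-δ : ∀ (A : Matrix ℤ n n) {i k} → i ≢ k → ∀ l m →
  determinant (A [ i ≔ A l ] [ k ≔ A m ]) ≡
  δ l i * (δ m k * determinant A) ⊕ δ l k * (δ m i * - determinant A)
det-two-rows-δ A {i} {k} i≢k l m with i ≟ l
... | yes refl = begin
  determinant (A [ l ≔ A l ] [ k ≔ A m ])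
    ≡⟨ det-≔-comm A (A l) (A m) i≢k ⟩
  determinant (A [ k ≔ A m ] [ l ≔ A l ])
    ≡⟨ cong (λ v → determinant (A [ k ≔ A m ] [ l ≔ v ])) (≔-minimal A (A m) i≢k) ⟨
  determinant (A [ k ≔ A m ] [ l ≔ (A [ k ≔ A m ]) l ])
    ≡⟨ det-row-own (A [ k ≔ A m ]) l ⟩
  determinant (A [ k ≔ A m ])
    ≡⟨ det-row-δ A k m ⟩
  δ m k * determinant A
    ≡⟨ lemma (δ m k * determinant A) (δ m l * - determinant A) ⟩
  1ℤ * (δ m k * determinant A) ⊕ 0ℤ * (δ m l * - determinant A)
    ≡⟨ cong₂ (λ x y → x * (δ m k * determinant A) ⊕ y * (δ m l * - determinant A))
         (δ-diagonal l) (δ-off-diagonal i≢k) ⟨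
  δ l l * (δ m k * determinant A) ⊕ δ l k * (δ m l * - determinant A) ∎
  where
  lemma : ∀ x y → x ≡ 1ℤ * x ⊕ 0ℤ * y
  lemma = solve-∀
... | no i≢l with k ≟ l
...   | yes refl = begin
  determinant (A [ i ≔ A l ] [ l ≔ A m ])
    ≡⟨ det-row-antisym A (A l) (A m) i≢k ⟩
  - determinant (A [ i ≔ A m ] [ l ≔ A l ])
    ≡⟨ cong (λ v → - determinant (A [ i ≔ A m ] [ l ≔ v ])) (≔-minimal A (A m) (i≢l ∘ sym)) ⟨
  - determinant (A [ i ≔ A m ] [ l ≔ (A [ i ≔ A m ]) l ])
    ≡⟨ cong -_ (trans (det-row-own (A [ i ≔ A m ]) l) (det-row-δ A i m)) ⟩
  - (δ m i * determinant A)
    ≡⟨ lemma (δ m l * determinant A) (δ m i) (determinant A) ⟩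
  0ℤ * (δ m l * determinant A) ⊕ 1ℤ * (δ m i * - determinant A)
    ≡⟨ cong₂ (λ x y → x * (δ m l * determinant A) ⊕ y * (δ m i * - determinant A))
         (δ-off-diagonal (i≢l ∘ sym)) (δ-diagonal l) ⟨
  δ l i * (δ m l * determinant A) ⊕ δ l l * (δ m i * - determinant A) ∎
  where
  lemma : ∀ x y z → - (y * z) ≡ 0ℤ * x ⊕ 1ℤ * (y * - z)
  lemma = solve-∀
...   | no k≢l = begin
  determinant (A [ i ≔ A l ] [ k ≔ A m ])
    ≡⟨ det-≔-comm A (A l) (A m) i≢k ⟩
  determinant (A [ k ≔ A m ] [ i ≔ A l ])
    ≡⟨ cong (λ v → determinant (A [ k ≔ A m ] [ i ≔ v ])) (≔-minimal A (A m) (k≢l ∘ sym)) ⟨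
  determinant (A [ k ≔ A m ] [ i ≔ (A [ k ≔ A m ]) l ])
    ≡⟨ det-duplicate-row (A [ k ≔ A m ]) i≢l ⟩
  0ℤ
    ≡⟨⟩
  0ℤ * (δ m k * determinant A) ⊕ 0ℤ * (δ m i * - determinant A)
    ≡⟨ cong₂ (λ x y → x * (δ m k * determinant A) ⊕ y * (δ m i * - determinant A))
         (δ-off-diagonal (i≢l ∘ sym)) (δ-off-diagonal (k≢l ∘ sym)) ⟨
  δ l i * (δ m k * determinant A) ⊕ δ l k * (δ m i * - determinant A) ∎

-- Jacobi's identity for a complementary minor of order two.
cramer₂ : ∀ (A : Matrix ℤ n n) {i k} (y z : Vector ℤ n) → i ≢ k →
  determinant (A [ i ≔ (λ j → sum (λ l → y l * A l j)) ] [ k ≔ (λ j → sum (λ m → z m * A m j)) ]) ≡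
  (y i * z k ⊕ - (y k * z i)) * determinant A
cramer₂ {n} A {i} {k} y z i≢k = begin
  determinant (A [ i ≔ yA ] [ k ≔ zA ])
    ≡⟨ det-row-combination (A [ i ≔ yA ]) k z A ⟩
  sum (λ m → z m * determinant (A [ i ≔ yA ] [ k ≔ A m ]))
    ≡⟨ sum-cong-≗ (λ m → cong (z m *_) (inner m)) ⟩
  sum (λ m → z m * (δ m k * (y i * d) ⊕ δ m i * - (y k * d)))
    ≡⟨ ∑-δ₂ z k i (y i * d) (- (y k * d)) ⟩
  z k * (y i * d) ⊕ z i * - (y k * d)
    ≡⟨ regroup (z k) (y i) (z i) (y k) d ⟩
  (y i * z k ⊕ - (y k * z i)) * d ∎
  where
  d : ℤ
  d = determinant A
  yA zA : Vector ℤ n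
  yA j = sum (λ l → y l * A l j)
  zA j = sum (λ m → z m * A m j)
  regroup : ∀ zk yi zi yk d → zk * (yi * d) ⊕ zi * - (yk * d) ≡ (yi * zk ⊕ - (yk * zi)) * d
  regroup = solve-∀
  rearrange : ∀ a b p q d → a * (p * d) ⊕ b * (q * - d) ≡ p * (a * d) ⊕ q * - (b * d)
  rearrange = solve-∀
  inner : ∀ m → determinant (A [ i ≔ yA ] [ k ≔ A m ]) ≡ δ m k * (y i * d) ⊕ δ m i * - (y k * d)
  inner m = begin
    determinant (A [ i ≔ yA ] [ k ≔ A m ])
      ≡⟨ det-≔-comm A yA (A m) i≢k ⟩
    determinant (A [ k ≔ A m ] [ i ≔ yA ])
      ≡⟨ det-row-combination (A [ k ≔ A m ]) i y A ⟩
    sum (λ l → y l * determinant (A [ k ≔ A m ] [ i ≔ A l ]))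
      ≡⟨ sum-cong-≗ (λ l → cong (y l *_)
           (trans (sym (det-≔-comm A (A l) (A m) i≢k)) (det-two-rows-δ A i≢k l m))) ⟩
    sum (λ l → y l * (δ l i * (δ m k * d) ⊕ δ l k * (δ m i * - d)))
      ≡⟨ ∑-δ₂ y i k (δ m k * d) (δ m i * - d) ⟩
    y i * (δ m k * d) ⊕ y k * (δ m i * - d)
      ≡⟨ rearrange (y i) (y k) (δ m k) (δ m i) d ⟩
    δ m k * (y i * d) ⊕ δ m i * - (y k * d) ∎

-- Inverse matrices

module _ {c ℓ} (R : Ring c ℓ) where
  open Ring R hiding (zero) renaming (_+_ to _+′_; _*_ to _*′_; refl to ≈-refl; sym to ≈-sym; trans to ≈-trans)
  private
    module Σ = Algebra.Properties.Semiring.Sum semiring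
    _·_ : ∀ {l m n} → Matrix Carrier l m → Matrix Carrier m n → Matrix Carrier l n
    _·_ = multiply rawRing

  multiply-assoc : ∀ {l m n o} (A : Matrix Carrier l m) (B : Matrix Carrier m n) (D : Matrix Carrier n o) →
    ∀ i j → ((A · B) · D) i j ≈ (A · (B · D)) i j
  multiply-assoc A B D i j = ≈-trans (Σ.sum-cong-≋ λ l → Σ.*-distribʳ-sum (D l j) (λ k → A i k *′ B k l))
    (≈-trans (Σ.∑-comm λ l k → A i k *′ B k l *′ D l j)
      (Σ.sum-cong-≋ λ k → ≈-trans (Σ.sum-cong-≋ λ l → *-assoc (A i k) (B k l) (D l j))
        (≈-sym (Σ.*-distribˡ-sum (A i k) (λ l → B k l *′ D l j)))))

  multiply-identityˡ : ∀ (A : Matrix Carrier m n) i j → (identity rawRing m · A) i j ≈ A i j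
  multiply-identityˡ {suc m} A zero j = ≈-trans (+-cong (*-identityˡ (A zero j))
    (≈-trans (Σ.sum-cong-≋ λ k → zeroˡ (A (suc k) j)) (Σ.sum-replicate-zero m))) (+-identityʳ (A zero j))
  multiply-identityˡ {suc m} A (suc i) j = ≈-trans (+-cong (zeroˡ (A zero j))
    (multiply-identityˡ (A ∘ suc) i j)) (+-identityˡ (A (suc i) j))

  multiply-identityʳ : ∀ (A : Matrix Carrier m n) i j → (A · identity rawRing n) i j ≈ A i j
  multiply-identityʳ {n = suc n} A i zero = ≈-trans (+-cong (*-identityʳ (A i zero))
    (≈-trans (Σ.sum-cong-≋ λ k → zeroʳ (A i (suc k))) (Σ.sum-replicate-zero n))) (+-identityʳ (A i zero))
  multiply-identityʳ {n = suc n} A i (suc j) = ≈-trans (+-cong (zeroʳ (A i zero))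
    (multiply-identityʳ (λ i → A i ∘ suc) i j)) (+-identityˡ (A i (suc j)))

  -- `L = L (A M) = (L A) M = M`. The ring is arbitrary because this serves over the integers for
  -- the skewness of the inverse and over the rationals for its uniqueness.
  left-inverse≈right-inverse : ∀ (L A M : Matrix Carrier n n) →
    (∀ i j → (L · A) i j ≈ identity rawRing n i j) → (∀ i j → (A · M) i j ≈ identity rawRing n i j) →
    ∀ i j → L i j ≈ M i j
  left-inverse≈right-inverse L A M LA≈I AM≈I i j =
    ≈-trans (≈-sym (multiply-identityʳ L i j))
    (≈-trans (Σ.sum-cong-≋ λ k → *-congˡ (≈-sym (AM≈I k j)))
    (≈-trans (≈-sym (multiply-assoc L A M i j))
    (≈-trans (Σ.sum-cong-≋ λ k → *-congʳ (LA≈I i k))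
    (multiply-identityˡ M i j))))

_⊡_ : Matrix ℤ m n → Matrix ℤ n o → Matrix ℤ m o
_⊡_ = multiply ℤ-rawRing

-- Expanding along row i shows that adjugate A c i is the usual (i , c) cofactor.
adjugate : Matrix ℤ n n → Matrix ℤ n n
adjugate A c i = determinant (A [ i ≔ δ c ])

-- By linearity in row `i`, the unit rows weighted with `A k c` reassemble row `k` of `A`, so the
-- sum is the determinant with row `k` copied into row `i`.
multiply-adjugate : ∀ (A : Matrix ℤ n n) k i → (A ⊡ adjugate A) k i ≡ δ k i * determinant A
multiply-adjugate A k i = begin
  sum (λ c → A k c * determinant (A [ i ≔ δ c ]))
    ≡⟨ det-row-combination A i (A k) δ ⟨
  determinant (A [ i ≔ (λ j → sum (λ c → A k c * δ c j)) ])
    ≡⟨ det-row-cong A i (∑-δ (A k)) ⟩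
  determinant (A [ i ≔ A k ])
    ≡⟨ det-row-δ A i k ⟩
  δ k i * determinant A ∎

-- Skew-symmetric matrices and skew-adjacency matrices

SkewSymmetric : Matrix ℤ n n → Set
SkewSymmetric A = ∀ i j → A j i ≡ - A i j

∑-neg : (f : Vector ℤ n) → sum (λ i → - f i) ≡ - sum f
∑-neg f = trans (sum-cong-≗ λ i → sym (ℤ.-1*i≡-i (f i)))
  (trans (sym (*-distribˡ-sum -1ℤ f)) (ℤ.-1*i≡-i (sum f)))

-- Transposing A B = I gives (- Bᵀ) A = I, so - Bᵀ is a left inverse and therefore equals B.
right-inverse-skew : ∀ (A B : Matrix ℤ n n) → SkewSymmetric A → (∀ i j → (A ⊡ B) i j ≡ δ i j) →
  SkewSymmetric B
right-inverse-skew A B A-skew AB≡I i j = begin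
  B j i       ≡⟨ ℤ.neg-involutive (B j i) ⟨
  - - B j i   ≡⟨ cong -_ (left-inverse≈right-inverse ℤ.+-*-ring -Bᵀ A B -BᵀA≡I AB≡I i j) ⟩
  - B i j     ∎
  where
  -Bᵀ : Matrix ℤ _ _
  -Bᵀ i j = - B j i
  lemma : ∀ a b → - a * - b ≡ b * a
  lemma = solve-∀
  -BᵀA≡I : ∀ i j → (-Bᵀ ⊡ A) i j ≡ δ i j
  -BᵀA≡I i j = begin
    sum (λ k → - B k i * A k j)    ≡⟨ sum-cong-≗ (λ k → cong (- B k i *_) (A-skew j k)) ⟩
    sum (λ k → - B k i * - A j k)  ≡⟨ sum-cong-≗ (λ k → lemma (B k i) (A j k)) ⟩
    sum (λ k → A j k * B k i)      ≡⟨ AB≡I j i ⟩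
    δ j i                          ≡⟨ δ-sym j i ⟩
    δ i j                          ∎

-- When both factors are skew the two signs cancel, and `B A` is the transpose of `A B`.
skew-right-inverse⇒left-inverse : ∀ (A B : Matrix ℤ n n) → SkewSymmetric A →
  (∀ i j → (A ⊡ B) i j ≡ δ i j) → ∀ i j → (B ⊡ A) i j ≡ δ i j
skew-right-inverse⇒left-inverse A B A-skew AB≡I i j = begin
  sum (λ k → B i k * A k j)
    ≡⟨ sum-cong-≗ (λ k → trans (cong₂ _*_ (right-inverse-skew A B A-skew AB≡I k i) (A-skew j k))
         (lemma (B k i) (A j k))) ⟩
  sum (λ k → A j k * B k i)  ≡⟨ AB≡I j i ⟩
  δ j i                      ≡⟨ δ-sym j i ⟩
  δ i j                      ∎
  where
  lemma : ∀ a b → - a * - b ≡ b * a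
  lemma = solve-∀

skew-diagonal : ∀ (A : Matrix ℤ n n) → SkewSymmetric A → ∀ i → A i i ≡ 0ℤ
skew-diagonal A A-skew i with A i i | A-skew i i
-- For a nonzero integer the two sides of `x = - x` have different constructors.
... | + 0 | _ = refl

skew-principal-minor₂ : ∀ (Y : Matrix ℤ n n) → SkewSymmetric Y → ∀ i k → Y i i * Y k k ⊕ - (Y i k * Y k i) ≡ Y i k * Y i k
skew-principal-minor₂ Y Y-skew i k = trans
  (cong₂ (λ a b → a * Y k k ⊕ - (Y i k * b)) (skew-diagonal Y Y-skew i) (Y-skew i k))
  (lemma (Y k k) (Y i k))
  where
  lemma : ∀ y z → 0ℤ * y ⊕ - (z * - z) ≡ z * z
  lemma = solve-∀

skewAdjacency-skew : (T : Tournament n) → SkewSymmetric (skewAdjacency T)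
skewAdjacency-skew T i j with Tournament.compare T i j | Tournament.compare T j i
... | tri< _ _ _    | tri> _ _ _    = refl
... | tri≈ _ _ _    | tri≈ _ _ _    = refl
... | tri> _ _ _    | tri< _ _ _    = refl
... | tri< _ _ ¬d   | tri< d _ _    = contradiction d ¬d
... | tri< _ i≢j _  | tri≈ _ j≡i _  = contradiction (sym j≡i) i≢j
... | tri≈ ¬d _ _   | tri> _ _ d    = contradiction d ¬d
... | tri≈ _ _ ¬d   | tri< d _ _    = contradiction d ¬d
... | tri> _ i≢j _  | tri≈ _ j≡i _  = contradiction (sym j≡i) i≢j
... | tri> ¬d _ _   | tri> _ _ d    = contradiction d ¬d

-- Modulo 2 the skew-adjacency matrix of a tournament is J - I.
skewAdjacency-parity : (T : Tournament n) → ∃[ X ] ∀ i j →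
  skewAdjacency T i j ≡ 1ℤ ⊕ - δ i j ⊕ + 2 * X i j
skewAdjacency-parity {n} T = X , parity
  where
  X : Matrix ℤ n n
  X i j with Tournament.compare T i j
  ... | tri< _ _ _ = 0ℤ
  ... | tri≈ _ _ _ = 0ℤ
  ... | tri> _ _ _ = -1ℤ
  parity : ∀ i j → skewAdjacency T i j ≡ 1ℤ ⊕ - δ i j ⊕ + 2 * X i j
  parity i j with Tournament.compare T i j
  ... | tri< _ i≢j _  = cong (λ d → 1ℤ ⊕ - d ⊕ 0ℤ) (sym (δ-off-diagonal i≢j))
  ... | tri≈ _ refl _ = cong (λ d → 1ℤ ⊕ - d ⊕ 0ℤ) (sym (δ-diagonal i))
  ... | tri> _ i≢j _  = cong (λ d → 1ℤ ⊕ - d ⊕ (+ 2 * -1ℤ)) (sym (δ-off-diagonal i≢j))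

∑-one : ∀ n → sum {n} (const 1ℤ) ≡ + n
∑-one zero    = refl
∑-one (suc n) = cong (1ℤ ⊕_) (∑-one n)

∑-δ-column : ∀ (j : Fin n) → sum (λ i → δ i j) ≡ 1ℤ
∑-δ-column j = trans (sum-cong-≗ λ i → sym (ℤ.*-identityˡ (δ i j))) (∑-δ (const 1ℤ) j)

-- Parity

halve : ∀ n → ∃[ m ] (n ≡ m ℕ.+ m ⊎ n ≡ suc (m ℕ.+ m))
halve zero = zero , inj₁ refl
halve (suc n) with halve n
... | m , inj₁ eq = m , inj₂ (cong suc eq)
... | m , inj₂ eq = suc m , inj₁ (cong suc (trans eq (sym (ℕ.+-suc m m))))

+2m : ∀ m → + (m ℕ.+ m) ≡ + 2 * + m
+2m m = trans (ℤ.pos-+ m m) (lemma (+ m))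
  where
  lemma : ∀ x → x ⊕ x ≡ + 2 * x
  lemma = solve-∀

2*≢1 : ∀ x → + 2 * x ≢ 1ℤ
2*≢1 x eq = contradiction
  (ℕ.∣1⇒≡1 (ℤ.∣⇒∣ᵤ {+ 2} {1ℤ} (ℤ.divides x (trans (sym eq) (ℤ.*-comm (+ 2) x))))) λ ()

module _ (T : Tournament n) where
  private
    S = skewAdjacency T
    X = proj₁ (skewAdjacency-parity T)

  column-sum : ∀ j → sum (λ i → S i j) ≡ + n ⊕ -1ℤ ⊕ + 2 * sum (λ i → X i j)
  column-sum j = begin
    sum (λ i → S i j)
      ≡⟨ sum-cong-≗ (λ i → proj₂ (skewAdjacency-parity T) i j) ⟩
    sum (λ i → 1ℤ ⊕ - δ i j ⊕ + 2 * X i j)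
      ≡⟨ ∑-distrib-+ (λ i → 1ℤ ⊕ - δ i j) (λ i → + 2 * X i j) ⟩
    sum (λ i → 1ℤ ⊕ - δ i j) ⊕ sum (λ i → + 2 * X i j)
      ≡⟨ cong₂ _⊕_ (∑-distrib-+ (λ _ → 1ℤ) (λ i → - δ i j)) (sym (*-distribˡ-sum (+ 2) (λ i → X i j))) ⟩
    sum {n} (λ _ → 1ℤ) ⊕ sum (λ i → - δ i j) ⊕ + 2 * sum (λ i → X i j)
      ≡⟨ cong₂ (λ a b → a ⊕ b ⊕ + 2 * sum (λ i → X i j)) (∑-one n)
           (trans (∑-neg (λ i → δ i j)) (cong -_ (∑-δ-column j))) ⟩
    + n ⊕ -1ℤ ⊕ + 2 * sum (λ i → X i j) ∎

  module _ (B : Matrix ℤ n n) (SB≡I : ∀ i j → (S ⊡ B) i j ≡ δ i j) where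

    -- For odd n the column sums of S, that is the entries of (1 … 1) S, are even,
    -- whereas (1 … 1) S B = (1 … 1).
    invertible⇒even : ∃[ m ] n ≡ m ℕ.+ m
    invertible⇒even with halve n
    ... | m , inj₁ n≡2m = m , n≡2m
    ... | m , inj₂ refl = contradiction (begin
      + 2 * sum (λ j → w j * B j j₀)
        ≡⟨ *-distribˡ-sum (+ 2) (λ j → w j * B j j₀) ⟩
      sum (λ j → + 2 * (w j * B j j₀))
        ≡⟨ sum-cong-≗ (λ j → trans (sym (ℤ.*-assoc (+ 2) (w j) (B j j₀))) (cong (_* B j j₀) (sym (even j)))) ⟩
      sum (λ j → sum (λ i → S i j) * B j j₀)
        ≡⟨ sum-cong-≗ (λ j → *-distribʳ-sum (B j j₀) (λ i → S i j)) ⟩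
      sum (λ j → sum (λ i → S i j * B j j₀))
        ≡⟨ ∑-comm (λ j i → S i j * B j j₀) ⟩
      sum (λ i → (S ⊡ B) i j₀)
        ≡⟨ sum-cong-≗ (λ i → SB≡I i j₀) ⟩
      sum (λ i → δ i j₀)
        ≡⟨ ∑-δ-column j₀ ⟩
      1ℤ ∎) (2*≢1 (sum (λ j → w j * B j j₀)))
      where
      -- An odd `n` is a successor, so there is a column in which to read off the contradiction.
      j₀ : Fin n
      j₀ = zero
      w : Fin n → ℤ
      w j = + m ⊕ sum (λ i → X i j)
      lemma : ∀ m x → 1ℤ ⊕ + 2 * m ⊕ -1ℤ ⊕ + 2 * x ≡ + 2 * (m ⊕ x)
      lemma = solve-∀
      even : ∀ j → sum (λ i → S i j) ≡ + 2 * w j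
      even j = trans (column-sum j)
        (trans (cong (λ z → 1ℤ ⊕ z ⊕ -1ℤ ⊕ + 2 * sum (λ i → X i j)) (+2m m))
          (lemma (+ m) (sum (λ i → X i j))))

    -- For even n, modulo 2 one has S S = (J - I)² = n J - 2 J + I = I, hence B = S.
    square-parity : ∃[ Z ] ∀ i j → (S ⊡ S) i j ≡ δ i j ⊕ + 2 * Z i j
    square-parity with invertible⇒even
    ... | m , n≡2m = Z , λ i j → begin
      sum (λ k → S i k * S k j)
        ≡⟨ sum-cong-≗ (λ k → cong (_* S k j) (proj₂ (skewAdjacency-parity T) i k)) ⟩
      sum (λ k → (1ℤ ⊕ - δ i k ⊕ + 2 * X i k) * S k j)
        ≡⟨ sum-cong-≗ (λ k → expand (δ i k) (X i k) (S k j)) ⟩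
      sum (λ k → S k j ⊕ (- (δ i k * S k j) ⊕ + 2 * (X i k * S k j)))
        ≡⟨ ∑-distrib-+ (λ k → S k j) (λ k → - (δ i k * S k j) ⊕ + 2 * (X i k * S k j)) ⟩
      sum (λ k → S k j) ⊕ sum (λ k → - (δ i k * S k j) ⊕ + 2 * (X i k * S k j))
        ≡⟨ cong (sum (λ k → S k j) ⊕_) (∑-distrib-+ (λ k → - (δ i k * S k j)) (λ k → + 2 * (X i k * S k j))) ⟩
      sum (λ k → S k j) ⊕ (sum (λ k → - (δ i k * S k j)) ⊕ sum (λ k → + 2 * (X i k * S k j)))
        ≡⟨ cong₂ (λ a b → sum (λ k → S k j) ⊕ (a ⊕ b))
             (trans (∑-neg (λ k → δ i k * S k j)) (cong -_ (multiply-identityˡ ℤ.+-*-ring S i j)))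
             (sym (*-distribˡ-sum (+ 2) (λ k → X i k * S k j))) ⟩
      sum (λ k → S k j) ⊕ (- S i j ⊕ + 2 * (X ⊡ S) i j)
        ≡⟨ cong₂ (λ a b → a ⊕ (- b ⊕ + 2 * (X ⊡ S) i j))
             (trans (column-sum j) (cong (λ z → z ⊕ -1ℤ ⊕ + 2 * sum (λ k → X k j)) (trans (cong +_ n≡2m) (+2m m))))
             (proj₂ (skewAdjacency-parity T) i j) ⟩
      + 2 * + m ⊕ -1ℤ ⊕ + 2 * sum (λ k → X k j) ⊕ (- (1ℤ ⊕ - δ i j ⊕ + 2 * X i j) ⊕ + 2 * (X ⊡ S) i j)
        ≡⟨ collect (+ m) (sum (λ k → X k j)) (δ i j) (X i j) ((X ⊡ S) i j) ⟩
      δ i j ⊕ + 2 * (+ m ⊕ -1ℤ ⊕ sum (λ k → X k j) ⊕ - X i j ⊕ (X ⊡ S) i j) ∎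
      where
      Z : Matrix ℤ n n
      Z i j = + m ⊕ -1ℤ ⊕ sum (λ k → X k j) ⊕ - X i j ⊕ (X ⊡ S) i j
      expand : ∀ d x s → (1ℤ ⊕ - d ⊕ + 2 * x) * s ≡ s ⊕ (- (d * s) ⊕ + 2 * (x * s))
      expand = solve-∀
      collect : ∀ m w d x y → + 2 * m ⊕ -1ℤ ⊕ + 2 * w ⊕ (- (1ℤ ⊕ - d ⊕ + 2 * x) ⊕ + 2 * y) ≡
        d ⊕ + 2 * (m ⊕ -1ℤ ⊕ w ⊕ - x ⊕ y)
      collect = solve-∀

    -- Evaluate `B S S` in two ways: `(B S) S = S`, and `B (S S) = B (I + 2 Z) = B + 2 B Z`.
    inverse-parity : ∃[ Y ] ∀ i j → S i j ≡ B i j ⊕ + 2 * Y i j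
    inverse-parity = Y , λ i j → begin
      S i j
        ≡⟨ multiply-identityˡ ℤ.+-*-ring S i j ⟨
      sum (λ k → δ i k * S k j)
        ≡⟨ sum-cong-≗ (λ k → cong (_* S k j) (BS≡I i k)) ⟨
      ((B ⊡ S) ⊡ S) i j
        ≡⟨ multiply-assoc ℤ.+-*-ring B S S i j ⟩
      sum (λ k → B i k * (S ⊡ S) k j)
        ≡⟨ sum-cong-≗ (λ k → trans (cong (B i k *_) (proj₂ square-parity k j)) (expand (B i k) (δ k j) (Z k j))) ⟩
      sum (λ k → B i k * δ k j ⊕ + 2 * (B i k * Z k j))
        ≡⟨ ∑-distrib-+ (λ k → B i k * δ k j) (λ k → + 2 * (B i k * Z k j)) ⟩
      sum (λ k → B i k * δ k j) ⊕ sum (λ k → + 2 * (B i k * Z k j))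
        ≡⟨ cong₂ _⊕_ (∑-δ (B i) j) (sym (*-distribˡ-sum (+ 2) (λ k → B i k * Z k j))) ⟩
      B i j ⊕ + 2 * Y i j ∎
      where
      Z = proj₁ square-parity
      Y = B ⊡ Z
      BS≡I = skew-right-inverse⇒left-inverse S B (skewAdjacency-skew T) SB≡I
      expand : ∀ b d z → b * (d ⊕ + 2 * z) ≡ b * d ⊕ + 2 * (b * z)
      expand = solve-∀

    inverse-odd : ∀ {i j} → i ≢ j → Odd (B i j)
    inverse-odd {i} {j} i≢j = X i j ⊕ - Y i j , (begin
      B i j
        ≡⟨ isolate (B i j) (Y i j) ⟩
      B i j ⊕ + 2 * Y i j ⊕ - (+ 2 * Y i j)
        ≡⟨ cong (_⊕ - (+ 2 * Y i j)) (proj₂ inverse-parity i j) ⟨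
      S i j ⊕ - (+ 2 * Y i j)
        ≡⟨ cong (_⊕ - (+ 2 * Y i j)) (proj₂ (skewAdjacency-parity T) i j) ⟩
      1ℤ ⊕ - δ i j ⊕ + 2 * X i j ⊕ - (+ 2 * Y i j)
        ≡⟨ cong (λ d → 1ℤ ⊕ - d ⊕ + 2 * X i j ⊕ - (+ 2 * Y i j)) (δ-off-diagonal i≢j) ⟩
      1ℤ ⊕ 0ℤ ⊕ + 2 * X i j ⊕ - (+ 2 * Y i j)
        ≡⟨ collect (X i j) (Y i j) ⟩
      + 2 * (X i j ⊕ - Y i j) ⊕ 1ℤ ∎)
      where
      Y = proj₁ inverse-parity
      isolate : ∀ b y → b ≡ b ⊕ + 2 * y ⊕ - (+ 2 * y)
      isolate = solve-∀
      collect : ∀ x y → 1ℤ ⊕ 0ℤ ⊕ + 2 * x ⊕ - (+ 2 * y) ≡ + 2 * (x ⊕ - y) ⊕ 1ℤ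
      collect = solve-∀

-- Row replacement and minors

≔-cong : ∀ {A B : Matrix ℤ m n} i {u v : Vector ℤ n} → (∀ r c → A r c ≡ B r c) → u ≗ v →
  ∀ r c → (A [ i ≔ u ]) r c ≡ (B [ i ≔ v ]) r c
≔-cong zero    A≗B u≗v zero    c = u≗v c
≔-cong zero    A≗B u≗v (suc r) c = A≗B (suc r) c
≔-cong (suc i) A≗B u≗v zero    c = A≗B zero c
≔-cong {A = A} {B} (suc i) A≗B u≗v (suc r) c = ≔-cong {A = A ∘ suc} {B ∘ suc} i (A≗B ∘ suc) u≗v r c

≔-minor : ∀ (A : Matrix ℤ (suc m) (suc n)) i k j u r c →
  minor (A [ punchIn i k ≔ u ]) i j r c ≡ (minor A i j [ k ≔ removeAt u j ]) r c
≔-minor A zero    zero    j u zero    c = refl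
≔-minor A zero    zero    j u (suc r) c = refl
≔-minor {suc m} A zero (suc k) j u zero c = refl
≔-minor {suc m} A zero (suc k) j u (suc r) c = ≔-minor (A ∘ suc) zero k j u r c
≔-minor A (suc i) zero    j u zero    c = refl
≔-minor A (suc i) zero    j u (suc r) c = refl
≔-minor A (suc i) (suc k) j u zero    c = refl
≔-minor A (suc i) (suc k) j u (suc r) c = ≔-minor (A ∘ suc) i k j u r c

det-≔-suc : ∀ (A : Matrix ℤ (suc n) (suc n)) i u → determinant (A [ suc i ≔ u ]) ≡
  sum (λ j → sgn j * (A zero j * determinant (minor A zero j [ i ≔ removeAt u j ])))
det-≔-suc A i u = sum-cong-≗ λ j → cong (λ d → sgn j * (A zero j * d)) (det-cong (≔-minor A zero i j u))

-- Interchanges the sum over differentiated rows with the expansion along the first row; the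
-- inductions for the derivatives of the determinant rest on it.
∑-pull : ∀ (s a : Vector ℤ m) (f : Fin m → Fin n → ℤ) →
  sum (λ i → sum (λ j → s j * (a j * f j i))) ≡ sum (λ j → s j * (a j * sum (f j)))
∑-pull s a f = trans (∑-comm λ i j → s j * (a j * f j i)) (sum-cong-≗ λ j → sym
  (trans (cong (s j *_) (*-distribˡ-sum (a j) (f j))) (*-distribˡ-sum (s j) (λ i → a j * f j i))))

-- The coefficient of x² in the characteristic polynomial

open Polynomial ℤ-rawRing using (addₚ; mulₚ; polyRawRing; constant)

coeff-addₚ : ∀ p q k → coeff (addₚ p q) k ≡ coeff p k ⊕ coeff q k
coeff-addₚ []      q       k       = sym (ℤ.+-identityˡ (coeff q k))
coeff-addₚ (a ∷ p) []      k       = sym (ℤ.+-identityʳ (coeff (a ∷ p) k))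
coeff-addₚ (a ∷ p) (b ∷ q) zero    = refl
coeff-addₚ (a ∷ p) (b ∷ q) (suc k) = coeff-addₚ p q k

coeff-scale : ∀ a q k → coeff (List.map (a *_) q) k ≡ a * coeff q k
coeff-scale a []      k       = sym (ℤ.*-zeroʳ a)
coeff-scale a (b ∷ q) zero    = refl
coeff-scale a (b ∷ q) (suc k) = coeff-scale a q k

coeff-drop : ∀ (p : Poly) k → coeff (List.drop 1 p) k ≡ coeff p (suc k)
coeff-drop []      k = refl
coeff-drop (a ∷ p) k = refl

coeff-mulₚ-zero : ∀ p q → coeff (mulₚ p q) 0 ≡ coeff p 0 * coeff q 0
coeff-mulₚ-zero []      q = sym (ℤ.*-zeroˡ (coeff q 0))
coeff-mulₚ-zero (a ∷ p) q = trans (coeff-addₚ (List.map (a *_) q) (0ℤ ∷ mulₚ p q) 0)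
  (trans (ℤ.+-identityʳ (coeff (List.map (a *_) q) 0)) (coeff-scale a q 0))

-- `List.drop 1` is a total tail: it removes the constant term of `p` and divides by `x`, so one
-- recursion covers the empty list as well.
coeff-mulₚ-suc : ∀ p q k →
  coeff (mulₚ p q) (suc k) ≡ coeff p 0 * coeff q (suc k) ⊕ coeff (mulₚ (List.drop 1 p) q) k
coeff-mulₚ-suc []      q k = sym (trans (ℤ.+-identityʳ (0ℤ * coeff q (suc k))) (ℤ.*-zeroˡ (coeff q (suc k))))
coeff-mulₚ-suc (a ∷ p) q k = trans (coeff-addₚ (List.map (a *_) q) (0ℤ ∷ mulₚ p q) (suc k))
  (cong (_⊕ coeff (mulₚ p q) k) (coeff-scale a q (suc k)))

coeff-mulₚ-one : ∀ p q → coeff (mulₚ p q) 1 ≡ coeff p 0 * coeff q 1 ⊕ coeff p 1 * coeff q 0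
coeff-mulₚ-one p q = trans (coeff-mulₚ-suc p q 0) (cong (coeff p 0 * coeff q 1 ⊕_)
  (trans (coeff-mulₚ-zero (List.drop 1 p) q) (cong (_* coeff q 0) (coeff-drop p 0))))

coeff-mulₚ-two : ∀ p q → coeff (mulₚ p q) 2 ≡
  coeff p 0 * coeff q 2 ⊕ (coeff p 1 * coeff q 1 ⊕ coeff p 2 * coeff q 0)
coeff-mulₚ-two p q = trans (coeff-mulₚ-suc p q 1) (cong (coeff p 0 * coeff q 2 ⊕_)
  (trans (coeff-mulₚ-one (List.drop 1 p) q)
    (cong₂ (λ a b → a * coeff q 1 ⊕ b * coeff q 0) (coeff-drop p 0) (coeff-drop p 1))))

-- Trailing zeros are allowed, so a vanishing polynomial need not be the empty list and has to be
-- recognised by its coefficients.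
coeff-zero-mulₚ : ∀ p q → (∀ k → coeff p k ≡ 0ℤ) → ∀ k → coeff (mulₚ p q) k ≡ 0ℤ
coeff-zero-mulₚ p q p≡0 zero    = trans (coeff-mulₚ-zero p q) (cong (_* coeff q 0) (p≡0 0))
coeff-zero-mulₚ p q p≡0 (suc k) = trans (coeff-mulₚ-suc p q k) (cong₂ _⊕_
  (cong (_* coeff q (suc k)) (p≡0 0))
  (coeff-zero-mulₚ (List.drop 1 p) q (λ l → trans (coeff-drop p l) (p≡0 (suc l))) k))

-- Turns the polynomial signs `-1ₚ ^ₚ m` in the expansion of a determinant into integer signs.
coeff-constant-mulₚ : ∀ p q → (∀ k → coeff p (suc k) ≡ 0ℤ) → ∀ k →
  coeff (mulₚ p q) k ≡ coeff p 0 * coeff q k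
coeff-constant-mulₚ p q p≡p₀ zero    = coeff-mulₚ-zero p q
coeff-constant-mulₚ p q p≡p₀ (suc k) = trans (coeff-mulₚ-suc p q k)
  (trans (cong (coeff p 0 * coeff q (suc k) ⊕_)
    (coeff-zero-mulₚ (List.drop 1 p) q (λ l → trans (coeff-drop p l) (p≡p₀ l)) k))
    (ℤ.+-identityʳ (coeff p 0 * coeff q (suc k))))

open RawSemiringDefinitions (RawRing.rawSemiring polyRawRing) using () renaming (sum to sumₚ; _^_ to _^ₚ_)

coeff-sumₚ : ∀ (f : Vector Poly n) k → coeff (sumₚ f) k ≡ sum (λ i → coeff (f i) k)
coeff-sumₚ {zero}  f k = refl
coeff-sumₚ {suc n} f k = trans (coeff-addₚ (f zero) (sumₚ (f ∘ suc)) k)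
  (cong (coeff (f zero) k ⊕_) (coeff-sumₚ (f ∘ suc) k))

-1ₚ : Poly
-1ₚ = -1ℤ ∷ []

coeff-sign : ∀ m → coeff (-1ₚ ^ₚ m) 0 ≡ -1ℤ ^ m × (∀ k → coeff (-1ₚ ^ₚ m) (suc k) ≡ 0ℤ)
coeff-sign zero    = refl , λ k → refl
coeff-sign (suc m) with coeff-sign m
... | eq₀ , eq₊ = trans (step 0) (cong (-1ℤ *_) eq₀) , λ k → trans (step (suc k)) (cong (-1ℤ *_) (eq₊ k))
  where
  step : ∀ k → coeff (-1ₚ ^ₚ suc m) k ≡ -1ℤ * coeff (-1ₚ ^ₚ m) k
  step = coeff-constant-mulₚ -1ₚ (-1ₚ ^ₚ m) (λ k → refl)

determinantₚ : Matrix Poly n n → Poly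
determinantₚ = det polyRawRing

minorₚ : Matrix Poly (suc n) (suc n) → Fin (suc n) → Matrix Poly n n
minorₚ P j r = removeAt (P (suc r)) j

coeff-determinantₚ : ∀ (P : Matrix Poly (suc n) (suc n)) k → coeff (determinantₚ P) k ≡
  sum (λ j → sgn j * coeff (mulₚ (P zero j) (determinantₚ (minorₚ P j))) k)
coeff-determinantₚ P k = trans (coeff-sumₚ term k) (sum-cong-≗ λ j → trans
  (coeff-constant-mulₚ (-1ₚ ^ₚ toℕ j) (product j) (proj₂ (coeff-sign (toℕ j))) k)
  (cong (_* coeff (product j) k) (proj₁ (coeff-sign (toℕ j)))))
  where
  product term : Vector Poly _
  product j = mulₚ (P zero j) (determinantₚ (minorₚ P j))
  term j = mulₚ (-1ₚ ^ₚ toℕ j) (product j)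

-- Describing `P = A + x D + …` by its low coefficients entry by entry is stable under passing to
-- minors, which is all that the inductions on the size require.
HasCoeff : ℕ → Matrix Poly m n → Matrix ℤ m n → Set
HasCoeff k P A = ∀ i j → coeff (P i j) k ≡ A i j

coeff₀-determinantₚ : ∀ (P : Matrix Poly n n) A → HasCoeff 0 P A → coeff (determinantₚ P) 0 ≡ determinant A
coeff₀-determinantₚ {zero}  P A P₀ = refl
coeff₀-determinantₚ {suc n} P A P₀ = trans (coeff-determinantₚ P 0) (sum-cong-≗ λ j →
  cong (sgn j *_) (trans (coeff-mulₚ-zero (P zero j) (determinantₚ (minorₚ P j)))
    (cong₂ _*_ (P₀ zero j) (coeff₀-determinantₚ (minorₚ P j) (minor A zero j) λ r c → P₀ (suc r) (punchIn j c)))))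

-- The first derivative at x = 0 of det (A + x D + …), by the Leibniz rule.
coeff₁-determinantₚ : ∀ (P : Matrix Poly n n) A D → HasCoeff 0 P A → HasCoeff 1 P D →
  coeff (determinantₚ P) 1 ≡ sum (λ i → determinant (A [ i ≔ D i ]))
coeff₁-determinantₚ {zero}  P A D P₀ P₁ = refl
coeff₁-determinantₚ {suc n} P A D P₀ P₁ = begin
  coeff (determinantₚ P) 1
    ≡⟨ coeff-determinantₚ P 1 ⟩
  sum (λ j → sgn j * coeff (mulₚ (P zero j) (determinantₚ (minorₚ P j))) 1)
    ≡⟨ sum-cong-≗ (λ j → trans (cong (sgn j *_) (leibniz j))
         (expand (sgn j) (A zero j) (D zero j) (d₀ j) (sum (d₁ j)))) ⟩
  sum (λ j → sgn j * (D zero j * d₀ j) ⊕ sgn j * (A zero j * sum (d₁ j)))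
    ≡⟨ ∑-distrib-+ (λ j → sgn j * (D zero j * d₀ j)) (λ j → sgn j * (A zero j * sum (d₁ j))) ⟩
  determinant (A [ zero ≔ D zero ]) ⊕ sum (λ j → sgn j * (A zero j * sum (d₁ j)))
    ≡⟨ cong (determinant (A [ zero ≔ D zero ]) ⊕_)
         (trans (sum-cong-≗ λ i → det-≔-suc A i (D (suc i))) (∑-pull sgn (A zero) d₁)) ⟨
  determinant (A [ zero ≔ D zero ]) ⊕ sum (λ i → determinant (A [ suc i ≔ D (suc i) ])) ∎
  where
  d₀ : Vector ℤ (suc n)
  d₀ j = determinant (minor A zero j)
  d₁ : Fin (suc n) → Fin n → ℤ
  d₁ j i = determinant (minor A zero j [ i ≔ minor D zero j i ])
  expand : ∀ s a c d e → s * (a * e ⊕ c * d) ≡ s * (c * d) ⊕ s * (a * e)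
  expand = solve-∀
  leibniz : ∀ j → coeff (mulₚ (P zero j) (determinantₚ (minorₚ P j))) 1 ≡
    A zero j * sum (d₁ j) ⊕ D zero j * d₀ j
  leibniz j = trans (coeff-mulₚ-one (P zero j) (determinantₚ (minorₚ P j))) (cong₂ _⊕_
    (cong₂ _*_ (P₀ zero j) (coeff₁-determinantₚ (minorₚ P j) (minor A zero j) (minor D zero j)
      (λ r c → P₀ (suc r) (punchIn j c)) (λ r c → P₁ (suc r) (punchIn j c))))
    (cong₂ _*_ (P₁ zero j) (coeff₀-determinantₚ (minorₚ P j) (minor A zero j) λ r c → P₀ (suc r) (punchIn j c))))

-- The contribution to the second derivative in which rows `i` and `k` are differentiated. Rows of
-- `A + x D` have no second derivative, hence the value zero for `i = k`.
mixed : Matrix ℤ n n → Matrix ℤ n n → Fin n → Fin n → ℤ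
mixed A D i k = if does (i ≟ k) then 0ℤ else determinant (A [ i ≔ D i ] [ k ≔ D k ])

mixed-suc : ∀ (A D : Matrix ℤ (suc n) (suc n)) i k → mixed A D (suc i) (suc k) ≡
  sum (λ j → sgn j * (A zero j * mixed (minor A zero j) (minor D zero j) i k))
mixed-suc A D i k with i ≟ k
... | yes _ = sym (∑-zero λ j → lemma (sgn j) (A zero j))
  where
  lemma : ∀ s a → s * (a * 0ℤ) ≡ 0ℤ
  lemma = solve-∀
... | no  _ = trans (det-≔-suc (A [ suc i ≔ D (suc i) ]) k (D (suc k))) (sum-cong-≗ λ j →
  cong (λ d → sgn j * (A zero j * d)) (det-cong
    (≔-cong {A = minor (A [ suc i ≔ D (suc i) ]) zero j} k {u = removeAt (D (suc k)) j}
      (≔-minor A zero i j (D (suc i))) λ _ → refl)))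

-- The second derivative; doubled, so that the sum runs over ordered pairs of rows.
coeff₂-determinantₚ : ∀ (P : Matrix Poly n n) A D → HasCoeff 0 P A → HasCoeff 1 P D → HasCoeff 2 P (λ _ _ → 0ℤ) →
  + 2 * coeff (determinantₚ P) 2 ≡ sum (λ i → sum (λ k → mixed A D i k))
coeff₂-determinantₚ {zero}  P A D P₀ P₁ P₂ = refl
coeff₂-determinantₚ {suc n} P A D P₀ P₁ P₂ = begin
  + 2 * coeff (determinantₚ P) 2
    ≡⟨ cong (+ 2 *_) (coeff-determinantₚ P 2) ⟩
  + 2 * sum (λ j → sgn j * coeff (mulₚ (P zero j) (determinantₚ (minorₚ P j))) 2)
    ≡⟨ *-distribˡ-sum (+ 2) (λ j → sgn j * coeff (mulₚ (P zero j) (determinantₚ (minorₚ P j))) 2) ⟩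
  sum (λ j → + 2 * (sgn j * coeff (mulₚ (P zero j) (determinantₚ (minorₚ P j))) 2))
    ≡⟨ sum-cong-≗ (λ j → leibniz j) ⟩
  sum (λ j → e j ⊕ (e j ⊕ f j))
    ≡⟨ trans (∑-distrib-+ e (λ j → e j ⊕ f j)) (cong (sum e ⊕_) (∑-distrib-+ e f)) ⟩
  sum e ⊕ (sum e ⊕ sum f)
    -- A pair of rows containing row `zero` occurs in both orders, whence two copies of `sum e`; the
    -- pairs avoiding it carry the doubled coefficient of the minors.
    ≡⟨ cong₂ _⊕_ (trans (ℤ.+-identityˡ _) first-row) (cong₂ _⊕_ first-column rest) ⟨
  (0ℤ ⊕ sum (λ k → mixed A D zero (suc k))) ⊕
    (sum (λ i → mixed A D (suc i) zero) ⊕ sum (λ i → sum (λ k → mixed A D (suc i) (suc k))))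
    ≡⟨ cong ((0ℤ ⊕ sum (λ k → mixed A D zero (suc k))) ⊕_)
         (∑-distrib-+ (λ i → mixed A D (suc i) zero) (λ i → sum (λ k → mixed A D (suc i) (suc k)))) ⟨
  sum (λ i → sum (λ k → mixed A D i k)) ∎
  where
  d₁ : Fin (suc n) → Fin n → ℤ
  d₁ j i = determinant (minor A zero j [ i ≔ minor D zero j i ])
  d₂ : Fin (suc n) → Fin n → Fin n → ℤ
  d₂ j = mixed (minor A zero j) (minor D zero j)
  e f : Vector ℤ (suc n)
  e j = sgn j * (D zero j * sum (d₁ j))
  f j = sgn j * (A zero j * sum (λ i → sum (d₂ j i)))
  expand : ∀ s a x c y z → + 2 * (s * (a * x ⊕ (c * y ⊕ 0ℤ * z))) ≡
    s * (c * y) ⊕ (s * (c * y) ⊕ s * (a * (+ 2 * x)))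
  expand = solve-∀
  leibniz : ∀ j → + 2 * (sgn j * coeff (mulₚ (P zero j) (determinantₚ (minorₚ P j))) 2) ≡ e j ⊕ (e j ⊕ f j)
  leibniz j = begin
    + 2 * (sgn j * coeff (mulₚ (P zero j) q) 2)
      ≡⟨ cong (λ z → + 2 * (sgn j * z)) (coeff-mulₚ-two (P zero j) q) ⟩
    + 2 * (sgn j * (coeff (P zero j) 0 * coeff q 2 ⊕ (coeff (P zero j) 1 * coeff q 1 ⊕ coeff (P zero j) 2 * coeff q 0)))
      ≡⟨ cong (λ z → + 2 * (sgn j * z)) (cong₂ _⊕_ (cong (_* coeff q 2) (P₀ zero j))
           (cong₂ _⊕_ (cong₂ _*_ (P₁ zero j) (coeff₁-determinantₚ (minorₚ P j) (minor A zero j) (minor D zero j) q₀ q₁))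
             (cong (_* coeff q 0) (P₂ zero j)))) ⟩
    + 2 * (sgn j * (A zero j * coeff q 2 ⊕ (D zero j * sum (d₁ j) ⊕ 0ℤ * coeff q 0)))
      ≡⟨ expand (sgn j) (A zero j) (coeff q 2) (D zero j) (sum (d₁ j)) (coeff q 0) ⟩
    e j ⊕ (e j ⊕ sgn j * (A zero j * (+ 2 * coeff q 2)))
      ≡⟨ cong (λ z → e j ⊕ (e j ⊕ sgn j * (A zero j * z)))
           (coeff₂-determinantₚ (minorₚ P j) (minor A zero j) (minor D zero j) q₀ q₁ (λ r c → P₂ (suc r) (punchIn j c))) ⟩
    e j ⊕ (e j ⊕ f j) ∎
    where
    q = determinantₚ (minorₚ P j)
    q₀ = λ r c → P₀ (suc r) (punchIn j c)
    q₁ = λ r c → P₁ (suc r) (punchIn j c)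
  first-row : sum (λ k → mixed A D zero (suc k)) ≡ sum e
  first-row = trans (sum-cong-≗ λ k → det-≔-suc (A [ zero ≔ D zero ]) k (D (suc k))) (∑-pull sgn (D zero) d₁)
  first-column : sum (λ i → mixed A D (suc i) zero) ≡ sum e
  first-column = trans (sum-cong-≗ λ i → det-≔-comm A {suc i} {zero} (D (suc i)) (D zero) λ ()) first-row
  rest : sum (λ i → sum (λ k → mixed A D (suc i) (suc k))) ≡ sum f
  rest = trans (sum-cong-≗ λ i → trans (sum-cong-≗ λ k → mixed-suc A D i k) (∑-pull sgn (A zero) (λ j → d₂ j i)))
    (∑-pull sgn (A zero) (λ j i → sum (d₂ j i)))

negate : Matrix ℤ m n → Matrix ℤ m n
negate A i j = - A i j

coeff₂-charPoly : ∀ (A : Matrix ℤ n n) → + 2 * coeff (charPoly A) 2 ≡ sum (λ i → sum (λ k → mixed (negate A) δ i k))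
coeff₂-charPoly {n} A = coeff₂-determinantₚ P (negate A) δ P₀ P₁ P₂
  where
  open Polynomial ℤ-rawRing using (indeterminate)
  P : Matrix Poly n n
  P i j = addₚ (mulₚ indeterminate (identity polyRawRing n i j)) (List.map -_ (constant (A i j)))
  P₀ : HasCoeff 0 P (negate A)
  P₀ i j with does (i ≟ j)
  ... | true  = ℤ.+-identityˡ (- A i j)
  ... | false = ℤ.+-identityˡ (- A i j)
  P₁ : HasCoeff 1 P δ
  P₁ i j with does (i ≟ j)
  ... | true  = refl
  ... | false = refl
  P₂ : HasCoeff 2 P (λ _ _ → 0ℤ)
  P₂ i j with does (i ≟ j)
  ... | true  = refl
  ... | false = refl

det-negate : ∀ (A : Matrix ℤ n n) → determinant (negate A) ≡ -1ℤ ^ n * determinant A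
det-negate {zero}  A = refl
det-negate {suc n} A = begin
  sum (λ j → sgn j * (- A zero j * determinant (negate (minor A zero j))))
    ≡⟨ sum-cong-≗ (λ j → trans (cong (λ d → sgn j * (- A zero j * d)) (det-negate (minor A zero j)))
         (regroup (sgn j) (A zero j) (-1ℤ ^ n) (determinant (minor A zero j)))) ⟩
  sum (λ j → (-1ℤ * -1ℤ ^ n) * (sgn j * (A zero j * determinant (minor A zero j))))
    ≡⟨ *-distribˡ-sum (-1ℤ ^ suc n) (λ j → sgn j * (A zero j * determinant (minor A zero j))) ⟨
  -1ℤ ^ suc n * determinant A ∎
  where
  regroup : ∀ s a e d → s * (- a * (e * d)) ≡ (-1ℤ * e) * (s * (a * d))
  regroup = solve-∀

-1^[m+m]≡1 : ∀ m → -1ℤ ^ (m ℕ.+ m) ≡ 1ℤ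
-1^[m+m]≡1 zero    = refl
-1^[m+m]≡1 (suc m) = trans (cong (λ k → -1ℤ * -1ℤ ^ k) (ℕ.+-suc m m))
  (cong (λ x → -1ℤ * (-1ℤ * x)) (-1^[m+m]≡1 m))

det-≔-δ-δ : ∀ (A Y : Matrix ℤ n n) → (∀ i j → (Y ⊡ A) i j ≡ δ i j) → ∀ {i k} → i ≢ k →
  determinant (A [ i ≔ δ i ] [ k ≔ δ k ]) ≡ (Y i i * Y k k ⊕ - (Y i k * Y k i)) * determinant A
det-≔-δ-δ A Y YA≡I {i} {k} i≢k = trans
  (det-cong (≔-cong {A = A [ i ≔ δ i ]} k (≔-cong {A = A} i (λ _ _ → refl) (λ j → sym (YA≡I i j))) λ j → sym (YA≡I k j)))
  (cramer₂ A (Y i) (Y k) i≢k)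

-- Principal minors and subtournaments

sgn-square : ∀ (i : Fin n) → sgn i * sgn i ≡ 1ℤ
sgn-square zero    = refl
sgn-square (suc i) = trans (lemma (sgn i)) (sgn-square i)
  where
  lemma : ∀ x → (-1ℤ * x) * (-1ℤ * x) ≡ x * x
  lemma = solve-∀

det-≔-δ : ∀ (A : Matrix ℤ (suc n) (suc n)) i → determinant (A [ i ≔ δ i ]) ≡ determinant (minor A i i)
det-≔-δ A i = begin
  determinant (A [ i ≔ δ i ])
    ≡⟨ laplace-≔ A i (δ i) ⟩
  sum (λ j → (sgn i * sgn j) * (δ i j * determinant (minor A i j)))
    ≡⟨ sum-cong-≗ (λ j → trans (cong (λ d → (sgn i * sgn j) * (d * determinant (minor A i j))) (δ-sym i j))
         (regroup (sgn i * sgn j) (δ j i) (determinant (minor A i j)))) ⟩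
  sum (λ j → (sgn i * sgn j) * determinant (minor A i j) * δ j i)
    ≡⟨ ∑-δ (λ j → (sgn i * sgn j) * determinant (minor A i j)) i ⟩
  (sgn i * sgn i) * determinant (minor A i i)
    ≡⟨ cong (_* determinant (minor A i i)) (sgn-square i) ⟩
  1ℤ * determinant (minor A i i)
    ≡⟨ ℤ.*-identityˡ (determinant (minor A i i)) ⟩
  determinant (minor A i i) ∎
  where
  regroup : ∀ s d m → s * (d * m) ≡ s * m * d
  regroup = solve-∀

δ-punchIn : ∀ i (j k : Fin n) → δ (punchIn i j) (punchIn i k) ≡ δ j k
δ-punchIn zero    j       k       = refl
δ-punchIn (suc i) zero    zero    = refl
δ-punchIn (suc i) zero    (suc k) = refl
δ-punchIn (suc i) (suc j) zero    = refl
δ-punchIn (suc i) (suc j) (suc k) = δ-punchIn i j k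

-- Expand along the unit row `i`. The other unit row loses its entry in column `i`, which is zero,
-- and remains a unit row of the minor, along which one expands again.
det-≔-δ-≔-δ : ∀ (A : Matrix ℤ (suc (suc n)) (suc (suc n))) i k →
  determinant (A [ i ≔ δ i ] [ punchIn i k ≔ δ (punchIn i k) ]) ≡ determinant (minor (minor A i i) k k)
det-≔-δ-≔-δ A i k = begin
  determinant (A [ i ≔ δ i ] [ k′ ≔ δ k′ ])
    ≡⟨ det-≔-comm A (δ i) (δ k′) (punchInᵢ≢i i k ∘ sym) ⟩
  determinant (A [ k′ ≔ δ k′ ] [ i ≔ δ i ])
    ≡⟨ det-≔-δ (A [ k′ ≔ δ k′ ]) i ⟩
  determinant (minor (A [ k′ ≔ δ k′ ]) i i)
    ≡⟨ det-cong (≔-minor A i k i (δ k′)) ⟩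
  determinant (minor A i i [ k ≔ removeAt (δ k′) i ])
    ≡⟨ det-row-cong (minor A i i) k (δ-punchIn i k) ⟩
  determinant (minor A i i [ k ≔ δ k ])
    ≡⟨ det-≔-δ (minor A i i) k ⟩
  determinant (minor (minor A i i) k k) ∎
  where
  k′ = punchIn i k

principal : Matrix ℤ n n → (p : Subset n) → Matrix ℤ ∣ p ∣ ∣ p ∣
principal A p i j = A (element p i) (element p j)

-- Sizes of subsets agree only propositionally; this confines the transport to the indices.
det-cast : ∀ (eq : m ≡ n) (A : Matrix ℤ m m) (B : Matrix ℤ n n) →
  (∀ i j → A i j ≡ B (cast eq i) (cast eq j)) → determinant A ≡ determinant B
det-cast refl A B A≗B = det-cong λ i j → trans (A≗B i j) (cong₂ B (cast-is-id refl i) (cast-is-id refl j))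

∣insertAt-outside∣ : ∀ (p : Subset n) i → ∣ insertAt p i outside ∣ ≡ ∣ p ∣
∣insertAt-outside∣ p             zero    = refl
∣insertAt-outside∣ (outside ∷ p) (suc i) = ∣insertAt-outside∣ p i
∣insertAt-outside∣ (inside  ∷ p) (suc i) = cong suc (∣insertAt-outside∣ p i)

element-insertAt : ∀ (p : Subset n) i .(eq : ∣ insertAt p i outside ∣ ≡ ∣ p ∣) j →
  element (insertAt p i outside) j ≡ punchIn i (element p (cast eq j))
element-insertAt p             zero    eq j       = cong (suc ∘ element p) (sym (cast-is-id eq j))
element-insertAt (outside ∷ p) (suc i) eq j       = cong suc (element-insertAt p i eq j)
element-insertAt (inside  ∷ p) (suc i) eq zero    = refl
element-insertAt (inside  ∷ p) (suc i) eq (suc j) = cong suc (element-insertAt p i (ℕ.suc-injective eq) j)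

element-⊤ : ∀ .(eq : ∣ ⊤ {n} ∣ ≡ n) j → element (⊤ {n}) j ≡ cast eq j
element-⊤ {suc n} eq zero    = refl
element-⊤ {suc n} eq (suc j) = cong suc (element-⊤ (ℕ.suc-injective eq) j)

-- `insertAt p i outside` is the image of `p` under `punchIn i`. Iterated from `⊤`, this matches
-- omitting vertices with deleting rows and columns.
det-principal-insertAt : ∀ (A : Matrix ℤ (suc n) (suc n)) p i →
  determinant (principal A (insertAt p i outside)) ≡ determinant (principal (minor A i i) p)
det-principal-insertAt A p i = det-cast eq _ _ λ r c →
  cong₂ A (element-insertAt p i eq r) (element-insertAt p i eq c)
  where
  eq = ∣insertAt-outside∣ p i

det-principal-⊤ : ∀ (A : Matrix ℤ n n) → determinant (principal A ⊤) ≡ determinant A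
det-principal-⊤ {n} A = det-cast (∣⊤∣≡n n) _ _ λ r c →
  cong₂ A (element-⊤ (∣⊤∣≡n n) r) (element-⊤ (∣⊤∣≡n n) c)

-- A subset that is too small to be full omits some vertex; the first one is taken. Two applications
-- bring a subset with two omitted vertices into the form of iterated minors.
insertAt-outside-view : ∀ (p : Subset (suc n)) → ∣ p ∣ ℕ.≤ n → ∃[ i ] ∃[ q ] p ≡ insertAt q i outside
insertAt-outside-view {n} (outside ∷ p) _ = zero , p , refl
insertAt-outside-view {suc n} (inside ∷ p) (ℕ.s≤s ∣p∣≤n) with insertAt-outside-view p ∣p∣≤n
... | i , q , refl = suc i , inside ∷ q , refl

skewAdjacency-subtournament : ∀ (T : Tournament n) p i j →
  skewAdjacency (subtournament T p) i j ≡ principal (skewAdjacency T) p i j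
skewAdjacency-subtournament T p i j with Tournament.compare T (element p i) (element p j)
... | tri< _ _ _ = refl
... | tri≈ _ _ _ = refl
... | tri> _ _ _ = refl

-- Sums of squares of odd integers

NonZeroOffDiagonal : Matrix ℤ n n → Set
NonZeroOffDiagonal B = ∀ i k → i ≢ k → B i k ≢ 0ℤ

-- Being 1 or -1 is stated through the square, the form in which both the complementary minors and
-- the coefficient of `x²` deliver it.
SignsOffDiagonal : Matrix ℤ n n → Set
SignsOffDiagonal B = ∀ i k → i ≢ k → B i k * B i k ≡ 1ℤ

odd⇒≢0 : ∀ {x} → Odd x → x ≢ 0ℤ
odd⇒≢0 (l , x≡2l+1) refl = 2*≢1 (- l) (trans (lemma l) (cong (λ z → - z ⊕ 1ℤ) (sym x≡2l+1)))
  where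
  lemma : ∀ l → + 2 * - l ≡ - (+ 2 * l ⊕ 1ℤ) ⊕ 1ℤ
  lemma = solve-∀

square≥1 : ∀ x → x ≢ 0ℤ → 1ℤ ℤ.≤ x * x
square≥1 (+ zero)     x≢0 = contradiction refl x≢0
square≥1 (+ suc m)    x≢0 = ℤ.+≤+ (ℕ.s≤s ℕ.z≤n)
square≥1 ℤ.-[1+ m ]   x≢0 = ℤ.+≤+ (ℕ.s≤s ℕ.z≤n)

square≡1 : ∀ x → x * x ≡ 1ℤ → x ≡ 1ℤ ⊎ x ≡ -1ℤ
square≡1 (+ suc zero)       eq = inj₁ refl
square≡1 ℤ.-[1+ zero ]      eq = inj₂ refl

∑-nonneg : ∀ (f : Vector ℤ n) → (∀ i → 0ℤ ℤ.≤ f i) → 0ℤ ℤ.≤ sum f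
∑-nonneg {zero}  f 0≤f = ℤ.≤-refl
∑-nonneg {suc n} f 0≤f = ℤ.+-mono-≤ (0≤f zero) (∑-nonneg (f ∘ suc) (0≤f ∘ suc))

nonneg-sum≡0 : ∀ {x y} → 0ℤ ℤ.≤ x → 0ℤ ℤ.≤ y → x ⊕ y ≡ 0ℤ → x ≡ 0ℤ × y ≡ 0ℤ
nonneg-sum≡0 {+ zero} {+ zero} (ℤ.+≤+ _) (ℤ.+≤+ _) eq = refl , refl

∑-nonneg≡0 : ∀ (f : Vector ℤ n) → (∀ i → 0ℤ ℤ.≤ f i) → sum f ≡ 0ℤ → ∀ i → f i ≡ 0ℤ
∑-nonneg≡0 f 0≤f ∑f≡0 zero    =
  proj₁ (nonneg-sum≡0 (0≤f zero) (∑-nonneg (f ∘ suc) (0≤f ∘ suc)) ∑f≡0)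
∑-nonneg≡0 f 0≤f ∑f≡0 (suc i) = ∑-nonneg≡0 (f ∘ suc) (0≤f ∘ suc)
  (proj₂ (nonneg-sum≡0 (0≤f zero) (∑-nonneg (f ∘ suc) (0≤f ∘ suc)) ∑f≡0)) i

∑-∸ : ∀ (f g : Vector ℤ n) → sum (λ i → f i ⊕ - g i) ≡ sum f ⊕ - sum g
∑-∸ f g = trans (∑-distrib-+ f (λ i → - g i)) (cong (sum f ⊕_) (∑-neg g))

∑∑-off-diagonal : ∀ n → sum {n} (λ i → sum {n} (λ k → 1ℤ ⊕ - δ i k)) ≡ + n * (+ n ⊕ -1ℤ)
∑∑-off-diagonal n = begin
  sum {n} (λ i → sum {n} (λ k → 1ℤ ⊕ - δ i k))
    ≡⟨ sum-cong-≗ {n} (λ i → trans (∑-∸ {n} (λ _ → 1ℤ) (δ i))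
         (cong₂ (λ a b → a ⊕ - b) (∑-one n) (trans (sum-cong-≗ (δ-sym i)) (∑-δ-column i)))) ⟩
  sum {n} (λ _ → + n ⊕ -1ℤ)
    ≡⟨ sum-cong-≗ {n} (λ _ → ℤ.*-identityˡ (+ n ⊕ -1ℤ)) ⟨
  sum {n} (λ _ → 1ℤ * (+ n ⊕ -1ℤ))
    ≡⟨ *-distribʳ-sum {n} (+ n ⊕ -1ℤ) (λ _ → 1ℤ) ⟨
  sum {n} (λ _ → 1ℤ) * (+ n ⊕ -1ℤ)
    ≡⟨ cong (_* (+ n ⊕ -1ℤ)) (∑-one n) ⟩
  + n * (+ n ⊕ -1ℤ) ∎

2*nC2 : ∀ n → + 2 * + (n C 2) ≡ + n * (+ n ⊕ -1ℤ)
2*nC2 zero    = refl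
2*nC2 (suc n) = begin
  + 2 * + (suc n C 2)
    ≡⟨ cong (λ c → + 2 * + c) (nCk+nC[k+1]≡[n+1]C[k+1] n 1) ⟨
  + 2 * + (n C 1 ℕ.+ n C 2)
    ≡⟨ cong (λ c → + 2 * + (c ℕ.+ n C 2)) (nC1≡n n) ⟩
  + 2 * (+ n ⊕ + (n C 2))
    ≡⟨ ℤ.*-distribˡ-+ (+ 2) (+ n) (+ (n C 2)) ⟩
  + 2 * + n ⊕ + 2 * + (n C 2)
    ≡⟨ cong (+ 2 * + n ⊕_) (2*nC2 n) ⟩
  + 2 * + n ⊕ + n * (+ n ⊕ -1ℤ)
    ≡⟨ lemma (+ n) ⟩
  (1ℤ ⊕ + n) * (1ℤ ⊕ + n ⊕ -1ℤ) ∎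
  where
  lemma : ∀ x → + 2 * x ⊕ x * (x ⊕ -1ℤ) ≡ (1ℤ ⊕ x) * (1ℤ ⊕ x ⊕ -1ℤ)
  lemma = solve-∀

-- Every square exceeds the corresponding entry of `J - I` by a nonnegative amount, and the entries
-- of `J - I` add up to `n (n - 1)`. Equality of the totals therefore forces each excess to vanish.
∑-squares-of-signs : ∀ (B : Matrix ℤ n n) → (∀ i → B i i ≡ 0ℤ) → NonZeroOffDiagonal B →
  SignsOffDiagonal B ⇔ (sum (λ i → sum (λ k → B i k * B i k)) ≡ + n * (+ n ⊕ -1ℤ))
∑-squares-of-signs {n} B B-diagonal B≢0 = mk⇔ to from
  where
  square : Matrix ℤ n n
  square i k = B i k * B i k
  to : SignsOffDiagonal B → sum (λ i → sum (square i)) ≡ + n * (+ n ⊕ -1ℤ)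
  to signs = trans (sum-cong-≗ λ i → sum-cong-≗ λ k → square≡1-δ i k) (∑∑-off-diagonal n)
    where
    square≡1-δ : ∀ i k → square i k ≡ 1ℤ ⊕ - δ i k
    square≡1-δ i k with i ≟ k
    ... | yes refl = cong (λ b → b * b) (B-diagonal i)
    ... | no i≢k   = signs i k i≢k
  from : sum (λ i → sum (square i)) ≡ + n * (+ n ⊕ -1ℤ) → SignsOffDiagonal B
  from eq i k i≢k = ℤ.i-j≡0⇒i≡j (square i k) 1ℤ (trans
    (cong (λ d → square i k ⊕ - (1ℤ ⊕ - d)) (sym (δ-off-diagonal i≢k)))
    (∑-nonneg≡0 (excess i) (excess≥0 i) (∑-nonneg≡0 (λ i → sum (excess i))
      (λ i → ∑-nonneg (excess i) (excess≥0 i)) ∑∑-excess≡0 i) k))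
    where
    excess : Matrix ℤ n n
    excess i k = square i k ⊕ - (1ℤ ⊕ - δ i k)
    excess≥0 : ∀ i k → 0ℤ ℤ.≤ excess i k
    excess≥0 i k with i ≟ k
    ... | yes refl = ℤ.≤-reflexive (sym (cong (λ b → b * b ⊕ 0ℤ) (B-diagonal i)))
    ... | no i≢k   = ℤ.i≤j⇒0≤j-i (square≥1 (B i k) (B≢0 i k i≢k))
    ∑∑-excess≡0 : sum (λ i → sum (excess i)) ≡ 0ℤ
    ∑∑-excess≡0 = begin
      sum (λ i → sum (excess i))
        ≡⟨ sum-cong-≗ (λ i → ∑-∸ (square i) (λ k → 1ℤ ⊕ - δ i k)) ⟩
      sum (λ i → sum (square i) ⊕ - sum (λ k → 1ℤ ⊕ - δ i k))
        ≡⟨ ∑-∸ (λ i → sum (square i)) (λ i → sum (λ k → 1ℤ ⊕ - δ i k)) ⟩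
      sum (λ i → sum (square i)) ⊕ - sum {n} (λ i → sum {n} (λ k → 1ℤ ⊕ - δ i k))
        ≡⟨ cong₂ (λ a b → a ⊕ - b) eq (∑∑-off-diagonal n) ⟩
      + n * (+ n ⊕ -1ℤ) ⊕ - (+ n * (+ n ⊕ -1ℤ))
        ≡⟨ ℤ.+-inverseʳ (+ n * (+ n ⊕ -1ℤ)) ⟩
      0ℤ ∎

signTournament : ∀ (B : Matrix ℤ n n) → SkewSymmetric B → SignsOffDiagonal B → Tournament n
signTournament B B-skew signs = record
  { _dominates_ = λ i j → B i j ≡ 1ℤ
  ; compare     = compare
  }
  where
  compare : ∀ i j → Tri (B i j ≡ 1ℤ) (i ≡ j) (B j i ≡ 1ℤ)
  compare i j with i ≟ j
  ... | yes refl = tri≈ Bii≢1 refl Bii≢1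
    where
    Bii≢1 : B i i ≢ 1ℤ
    Bii≢1 eq = contradiction (trans (sym eq) (skew-diagonal B B-skew i)) λ ()
  ... | no i≢j with square≡1 (B i j) (signs i j i≢j)
  ...   | inj₁ Bij≡1  = tri< Bij≡1 i≢j λ eq →
    contradiction (trans (sym eq) (trans (B-skew i j) (cong -_ Bij≡1))) λ ()
  ...   | inj₂ Bij≡-1 = tri> (λ eq → contradiction (trans (sym eq) Bij≡-1) λ ()) i≢j
    (trans (B-skew i j) (cong -_ Bij≡-1))

skewAdjacency-signTournament : ∀ (B : Matrix ℤ n n) (B-skew : SkewSymmetric B) (signs : SignsOffDiagonal B) →
  ∀ i j → skewAdjacency (signTournament B B-skew signs) i j ≡ B i j
skewAdjacency-signTournament B B-skew signs i j
  with Tournament.compare (signTournament B B-skew signs) i j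
... | tri< Bij≡1 _ _ = sym Bij≡1
... | tri≈ _ refl _  = sym (skew-diagonal B B-skew i)
... | tri> _ _ Bji≡1 = sym (trans (B-skew j i) (cong -_ Bji≡1))

skewAdjacency-signs : ∀ (T : Tournament n) → SignsOffDiagonal (skewAdjacency T)
skewAdjacency-signs T i j i≢j with Tournament.compare T i j
... | tri< _ _ _   = refl
... | tri≈ _ i≡j _ = contradiction i≡j i≢j
... | tri> _ _ _   = refl

-- Passage from the integers to the rationals

fromℤ-+ : ∀ a b → fromℤ (a ⊕ b) ≡ fromℤ a ℚ.+ fromℤ b
-- The rational sum is the normalised quotient `(a * 1 + b * 1) / 1`, so the left side is first
-- rewritten as a normalised quotient too.
fromℤ-+ a b = trans (sym (ℚ.↥p/↧p≡p (fromℤ (a ⊕ b))))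
  (cong (ℚ._/ 1) (sym (cong₂ _⊕_ (ℤ.*-identityʳ a) (ℤ.*-identityʳ b))))

fromℤ-* : ∀ a b → fromℤ (a * b) ≡ fromℤ a ℚ.* fromℤ b
fromℤ-* a b = sym (ℚ.↥p/↧p≡p (fromℤ (a * b)))

fromℤ-injective : ∀ {a b} → fromℤ a ≡ fromℤ b → a ≡ b
fromℤ-injective = cong ℚ.numerator

open RawSemiringDefinitions (RawRing.rawSemiring ℚ-rawRing) using () renaming (sum to sum-ℚ)

fromℤ-sum : ∀ (f : Vector ℤ n) → fromℤ (sum f) ≡ sum-ℚ (fromℤ ∘ f)
fromℤ-sum {zero}  f = refl
fromℤ-sum {suc n} f = trans (fromℤ-+ (f zero) (sum (f ∘ suc))) (cong (fromℤ (f zero) ℚ.+_) (fromℤ-sum (f ∘ suc)))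

sum-ℚ-cong : {f g : Vector ℚ n} → f ≗ g → sum-ℚ f ≡ sum-ℚ g
sum-ℚ-cong {zero}  f≗g = refl
sum-ℚ-cong {suc n} f≗g = cong₂ ℚ._+_ (f≗g zero) (sum-ℚ-cong (f≗g ∘ suc))

toℚ-inverse : ∀ (A B : Matrix ℤ n n) → (∀ i j → (A ⊡ B) i j ≡ δ i j) →
  ∀ i j → multiply ℚ-rawRing (toℚ A) (toℚ B) i j ≡ identity ℚ-rawRing n i j
toℚ-inverse A B AB≡I i j = begin
  sum-ℚ (λ k → fromℤ (A i k) ℚ.* fromℤ (B k j))
    ≡⟨ sum-ℚ-cong (λ k → fromℤ-* (A i k) (B k j)) ⟨
  sum-ℚ (λ k → fromℤ (A i k * B k j))
    ≡⟨ fromℤ-sum (λ k → A i k * B k j) ⟨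
  fromℤ ((A ⊡ B) i j)
    ≡⟨ cong fromℤ (AB≡I i j) ⟩
  fromℤ (δ i j)
    ≡⟨ fromℤ-δ ⟩
  identity ℚ-rawRing _ i j ∎
  where
  fromℤ-δ : fromℤ (δ i j) ≡ identity ℚ-rawRing _ i j
  fromℤ-δ with does (i ≟ j)
  ... | true  = refl
  ... | false = refl

-- The inverse of a unimodular tournament and its entries

module UnimodularTournament (T : Tournament n) (unimodular : Unimodular T) where
  S B : Matrix ℤ n n
  S = skewAdjacency T
  B = adjugate S

  SB≡I : ∀ i j → (S ⊡ B) i j ≡ δ i j
  SB≡I i j = trans (multiply-adjugate S i j) (trans (cong (δ i j *_) unimodular) (ℤ.*-identityʳ (δ i j)))

  BS≡I : ∀ i j → (B ⊡ S) i j ≡ δ i j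
  BS≡I = skew-right-inverse⇒left-inverse S B (skewAdjacency-skew T) SB≡I

  B-skew : SkewSymmetric B
  B-skew = right-inverse-skew S B (skewAdjacency-skew T) SB≡I

  B-odd : ∀ {i j} → i ≢ j → Odd (B i j)
  B-odd = inverse-odd T B SB≡I

  B-inverse : IsInverseOf (toℚ B) T
  B-inverse = toℚ-inverse S B SB≡I , toℚ-inverse B S BS≡I

  inverse-unique : ∀ M → IsInverseOf M T → ∀ i j → M i j ≡ fromℤ (B i j)
  inverse-unique M (_ , MS≡I) =
    left-inverse≈right-inverse ℚ.+-*-ring M (toℚ S) (toℚ B) MS≡I (proj₁ B-inverse)

  -- Uniqueness of the rational inverse identifies any `S′` with `B`. Conversely, a skew `B` with
  -- signs off the diagonal is itself a skew-adjacency matrix.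
  invertible⇔signs : Invertible T ⇔ SignsOffDiagonal B
  invertible⇔signs = mk⇔
    (λ (_ , T′ , S′-inverse) i k i≢k →
      trans (cong (λ b → b * b) (sym (fromℤ-injective (inverse-unique (toℚ (skewAdjacency T′)) S′-inverse i k))))
        (skewAdjacency-signs T′ i k i≢k))
    (λ signs →
      let S′   = skewAdjacency (signTournament B B-skew signs)
          S′≡B = skewAdjacency-signTournament B B-skew signs
      in unimodular , signTournament B B-skew signs ,
         toℚ-inverse S S′ (λ i j → trans (sum-cong-≗ λ k → cong (S i k *_) (S′≡B k j)) (SB≡I i j)) ,
         toℚ-inverse S′ S (λ i j → trans (sum-cong-≗ λ k → cong (_* S k j) (S′≡B i k)) (BS≡I i j)))

  coeff₂-charPoly≡∑-squares : + 2 * coeff (charPoly S) 2 ≡ sum (λ i → sum (λ k → B i k * B i k))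
  coeff₂-charPoly≡∑-squares = trans (coeff₂-charPoly S) (sum-cong-≗ λ i → sum-cong-≗ λ k → mixed≡square i k)
    where
    negate-negate : ∀ a b → - a * - b ≡ a * b
    negate-negate = solve-∀
    -- The constant part of `x I - S` is `- S`; passing to it is harmless because `n` is even.
    det-negate≡1 : determinant (negate S) ≡ 1ℤ
    det-negate≡1 with invertible⇒even T B SB≡I
    ... | m , n≡2m = trans (det-negate S) (cong₂ _*_ (trans (cong (-1ℤ ^_) n≡2m) (-1^[m+m]≡1 m)) unimodular)
    mixed≡square : ∀ i k → mixed (negate S) δ i k ≡ B i k * B i k
    mixed≡square i k with i ≟ k
    ... | yes refl = sym (cong (λ b → b * b) (skew-diagonal B B-skew i))
    ... | no i≢k   = begin
      determinant (negate S [ i ≔ δ i ] [ k ≔ δ k ])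
        -- The inverse of `- S` is `- B`, and its sign disappears in the square.
        ≡⟨ det-≔-δ-δ (negate S) (negate B)
             (λ i j → trans (sum-cong-≗ λ l → negate-negate (B i l) (S l j)) (BS≡I i j)) i≢k ⟩
      (negate B i i * negate B k k ⊕ - (negate B i k * negate B k i)) * determinant (negate S)
        ≡⟨ cong₂ _*_ (skew-principal-minor₂ (negate B) (λ i j → cong -_ (B-skew i j)) i k) det-negate≡1 ⟩
      negate B i k * negate B i k * 1ℤ
        ≡⟨ trans (ℤ.*-identityʳ _) (negate-negate (B i k) (B i k)) ⟩
      B i k * B i k ∎

  signs⇔coeff₂ : SignsOffDiagonal B ⇔ (coeff (charPoly S) 2 ≡ + (n C 2))
  signs⇔coeff₂ = mk⇔
    (λ signs → ℤ.*-cancelˡ-≡ (+ 2) _ _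
      (trans coeff₂-charPoly≡∑-squares (trans (Equivalence.to squares signs) (sym (2*nC2 n)))))
    (λ eq → Equivalence.from squares
      (trans (sym coeff₂-charPoly≡∑-squares) (trans (cong (+ 2 *_) eq) (2*nC2 n))))
    where
    squares = ∑-squares-of-signs B (skew-diagonal B B-skew) (λ i k → odd⇒≢0 ∘ B-odd)

-- Here `k` numbers the vertices other than `i`, so the second omitted vertex is `punchIn i k`.
-- Reading the principal minor as a determinant with two unit rows makes Jacobi's identity
-- applicable, and skewness of `B` reduces its two-by-two minor to a square.
complementary-minor : ∀ (T : Tournament (suc (suc m))) (unimodular : Unimodular T) i k →
  let open UnimodularTournament T unimodular in
  determinant (skewAdjacency (subtournament T (insertAt (insertAt ⊤ k outside) i outside))) ≡
  B i (punchIn i k) * B i (punchIn i k)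
complementary-minor T unimodular i k = begin
  determinant (skewAdjacency (subtournament T (insertAt (insertAt ⊤ k outside) i outside)))
    ≡⟨ det-cong (skewAdjacency-subtournament T (insertAt (insertAt ⊤ k outside) i outside)) ⟩
  determinant (principal S (insertAt (insertAt ⊤ k outside) i outside))
    ≡⟨ det-principal-insertAt S (insertAt ⊤ k outside) i ⟩
  determinant (principal (minor S i i) (insertAt ⊤ k outside))
    ≡⟨ det-principal-insertAt (minor S i i) ⊤ k ⟩
  determinant (principal (minor (minor S i i) k k) ⊤)
    ≡⟨ det-principal-⊤ (minor (minor S i i) k k) ⟩
  determinant (minor (minor S i i) k k)
    ≡⟨ det-≔-δ-≔-δ S i k ⟨
  determinant (S [ i ≔ δ i ] [ k′ ≔ δ k′ ])
    ≡⟨ det-≔-δ-δ S B BS≡I (punchInᵢ≢i i k ∘ sym) ⟩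
  (B i i * B k′ k′ ⊕ - (B i k′ * B k′ i)) * determinant S
    ≡⟨ cong₂ _*_ (skew-principal-minor₂ B B-skew i k′) unimodular ⟩
  B i k′ * B i k′ * 1ℤ
    ≡⟨ ℤ.*-identityʳ (B i k′ * B i k′) ⟩
  B i k′ * B i k′ ∎
  where
  open UnimodularTournament T unimodular
  k′ = punchIn i k

subtournaments⇔signs : ∀ (T : Tournament n) (unimodular : Unimodular T) →
  (∀ (p : Subset n) → ∣ p ∣ + 2 ≡ n → Unimodular (subtournament T p)) ⇔
  SignsOffDiagonal (UnimodularTournament.B T unimodular)
subtournaments⇔signs T unimodular = mk⇔ (to T unimodular) (from T unimodular)
  where
  to : ∀ {n} (T : Tournament n) unimodular →
    (∀ (p : Subset n) → ∣ p ∣ + 2 ≡ n → Unimodular (subtournament T p)) →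
    SignsOffDiagonal (UnimodularTournament.B T unimodular)
  to {suc zero} T unimodular minors zero zero i≢k = contradiction refl i≢k
  to {suc (suc m)} T unimodular minors i k i≢k = begin
    B i k * B i k
      ≡⟨ cong (λ k → B i k * B i k) (punchIn-punchOut i≢k) ⟨
    B i (punchIn i (punchOut i≢k)) * B i (punchIn i (punchOut i≢k))
      ≡⟨ complementary-minor T unimodular i (punchOut i≢k) ⟨
    determinant (skewAdjacency (subtournament T p))
      ≡⟨ minors p (trans (ℕ.+-comm ∣ p ∣ 2) (cong (λ k → suc (suc k)) ∣p∣≡m)) ⟩
    1ℤ ∎
    where
    open UnimodularTournament T unimodular
    p : Subset (suc (suc m))
    p = insertAt (insertAt ⊤ (punchOut i≢k) outside) i outside
    ∣p∣≡m : ∣ p ∣ ≡ m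
    ∣p∣≡m = trans (∣insertAt-outside∣ (insertAt ⊤ (punchOut i≢k) outside) i)
      (trans (∣insertAt-outside∣ ⊤ (punchOut i≢k)) (∣⊤∣≡n m))
  from : ∀ {n} (T : Tournament n) unimodular →
    SignsOffDiagonal (UnimodularTournament.B T unimodular) →
    ∀ (p : Subset n) → ∣ p ∣ + 2 ≡ n → Unimodular (subtournament T p)
  from {zero} T unimodular signs p eq = contradiction (trans (ℕ.+-comm 2 ∣ p ∣) eq) λ ()
  from {suc zero} T unimodular signs p eq = contradiction (trans (ℕ.+-comm 2 ∣ p ∣) eq) λ ()
  from {suc (suc m)} T unimodular signs p eq
    with ℕ.suc-injective (ℕ.suc-injective (trans (ℕ.+-comm 2 ∣ p ∣) eq))
  ... | ∣p∣≡m with insertAt-outside-view p (ℕ.m≤n⇒m≤1+n (ℕ.≤-reflexive ∣p∣≡m))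
  ... | i , q , refl with trans (sym (∣insertAt-outside∣ q i)) ∣p∣≡m
  ... | ∣q∣≡m with insertAt-outside-view q (ℕ.≤-reflexive ∣q∣≡m)
  -- With both omitted vertices split off, `r` has `m` elements among `m` vertices, so it is full
  -- and `p` has the shape required by `complementary-minor`.
  ... | k , r , refl with ∣p∣≡n⇒p≡⊤ {p = r} (trans (sym (∣insertAt-outside∣ r k)) ∣q∣≡m)
  ... | refl = trans (complementary-minor T unimodular i k) (signs i (punchIn i k) (punchInᵢ≢i i k ∘ sym))

proposition4p1 : ∀ (n : ℕ) (T : Tournament n) → Unimodular T →
    (∃[ S⁻¹ ] IsInverseOf S⁻¹ T)
    × (∀ (S⁻¹ : Matrix ℚ n n) → IsInverseOf S⁻¹ T →
    ∀ (i j : Fin n) → i ≢ j → ∃[ k ] (Odd k × S⁻¹ i j ≡ fromℤ k))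
    × (Invertible T
    ⇔ (∀ (p : Subset n) → ∣ p ∣ + 2 ≡ n → Unimodular (subtournament T p)))
    × ((∀ (p : Subset n) → ∣ p ∣ + 2 ≡ n → Unimodular (subtournament T p))
    ⇔ (coeff (charPoly (skewAdjacency T)) 2 ≡ + (n C 2)))
proposition4p1 n T unimodular =
    (toℚ B , B-inverse)
  , (λ S⁻¹ S⁻¹-inverse i j i≢j → B i j , B-odd i≢j , inverse-unique S⁻¹ S⁻¹-inverse i j)
  , ⇔-trans invertible⇔signs (⇔-sym (subtournaments⇔signs T unimodular))
  , ⇔-trans (subtournaments⇔signs T unimodular) signs⇔coeff₂
  where
  open UnimodularTournament T unimodular
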